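{- The set $X'$ has infinitely many elements.
   Context: For a positive integer $n$, $\sigma(n)$ denotes the sum of the positive divisors of $n$, and $\log$ is the natural logarithm. The set $X'$ of positive integers is defined recursively as follows. Let $n_1=10080$. Given $n_k$, let $n_{k+1}$ be the least integer $n>n_k$ (if such an integer exists; otherwise the construction stops) satisfying $$\frac{\sigma(n)/n}{\sigma(n_k)/n_k}>1+\frac{\log (n/n_k)}{\log n\,\log\log n_k}.$$ Then $X'$ is the set of all the integers $n_1,n_2,n_3,\ldots$ so obtained. -}

module Defs where

open import Data.Nat.Base as ℕ using (ℕ; zero; suc; s≤s; z≤n)
import Data.Nat.Properties as ℕₚ
open import Data.Nat.Divisibility using (_∣?_; 1∣_)
open import Data.Nat.ListAction using (sum)
open import Data.List.Base using (_∷_; filter; applyUpTo)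
open import Data.List.Properties using (filter-accept)
open import Data.Integer.Base as ℤ using (+_)
import Data.Integer.Properties as ℤₚ
open import Data.Rational.Base
open import Data.Rational.Properties
import Data.Rational.Unnormalised.Base as ℚᵘ
import Data.Rational.Unnormalised.Properties as ℚᵘₚ
open import Data.Rational.Solver using (module +-*-Solver)
open import Algebra.Definitions.RawSemiring +-*-rawSemiring using (_^_)
open import Data.Product.Base using (Σ-syntax; ∃-syntax; _×_; _,_; proj₁; proj₂)
open import Data.Sum.Base using (_⊎_; inj₁; inj₂)
open import Relation.Nullary using (¬_)
open import Relation.Nullary.Decidable using (toWitness)
open import Relation.Unary using (Pred)
open import Relation.Binary.PropositionalEquality
  using (_≡_; refl; sym; trans; cong; cong₂; subst; subst₂)
open import Level using (0ℓ)

open +-*-Solver using (solve; _:=_; _:+_; _:*_; _:-_; :-_; con)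
open ≤-Reasoning

2ℚ : ℚ
2ℚ = + 2 / 1

+-nonneg : ∀ {p q} → 0ℚ ≤ p → 0ℚ ≤ q → 0ℚ ≤ p + q
+-nonneg {p} {q} a b = subst (_≤ p + q) (+-identityˡ 0ℚ) (+-mono-≤ {0ℚ} {p} {0ℚ} {q} a b)

*-nonneg : ∀ {p q} → 0ℚ ≤ p → 0ℚ ≤ q → 0ℚ ≤ p * q
*-nonneg {p} {q} a b =
  subst (_≤ p * q) (*-zeroˡ q) (*-monoʳ-≤-nonNeg q {{nonNegative b}} a)

*-pos : ∀ {p q} → 0ℚ < p → 0ℚ < q → 0ℚ < p * q
*-pos {p} {q} a b = subst (_< p * q) (*-zeroˡ q) (*-monoˡ-<-pos q {{positive b}} a)

+-pos : ∀ {p q} → 0ℚ < p → 0ℚ < q → 0ℚ < p + q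
+-pos {p} {q} a b = subst (_< p + q) (+-identityˡ 0ℚ) (+-mono-< {0ℚ} {p} {0ℚ} {q} a b)

*-mono : ∀ {p q r s} → 0ℚ ≤ r → 0ℚ ≤ q → p ≤ q → r ≤ s → p * r ≤ q * s
*-mono {p} {q} {r} {s} r≥0 q≥0 p≤q r≤s = ≤-trans
  (*-monoʳ-≤-nonNeg r {{nonNegative r≥0}} p≤q)
  (*-monoˡ-≤-nonNeg q {{nonNegative q≥0}} r≤s)

*-monoˡ : ∀ {p q} r → 0ℚ ≤ r → p ≤ q → r * p ≤ r * q
*-monoˡ r r≥0 = *-monoˡ-≤-nonNeg r {{nonNegative r≥0}}

*-monoʳ : ∀ {p q} r → 0ℚ ≤ r → p ≤ q → p * r ≤ q * r
*-monoʳ r r≥0 = *-monoʳ-≤-nonNeg r {{nonNegative r≥0}}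

*-cancel : ∀ {p q} r → 0ℚ < r → p * r ≤ q * r → p ≤ q
*-cancel r r>0 = *-cancelʳ-≤-pos r {{positive r>0}}

p≤p+q : ∀ p q → 0ℚ ≤ q → p ≤ p + q
p≤p+q p q q≥0 = subst (_≤ p + q) (+-identityʳ p) (+-monoʳ-≤ p {0ℚ} {q} q≥0)

0≤1 : 0ℚ ≤ 1ℚ
0≤1 = toWitness {a? = 0ℚ ≤? 1ℚ} _

0<1 : 0ℚ < 1ℚ
0<1 = toWitness {a? = 0ℚ <? 1ℚ} _

0≤2 : 0ℚ ≤ 2ℚ
0≤2 = toWitness {a? = 0ℚ ≤? 2ℚ} _

0<2 : 0ℚ < 2ℚ
0<2 = toWitness {a? = 0ℚ <? 2ℚ} _

sub-nonneg : ∀ {p q} → p ≤ q → 0ℚ ≤ q - p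
sub-nonneg {p} {q} p≤q = subst (_≤ q - p) (+-inverseʳ p) (+-monoˡ-≤ (- p) p≤q)

sub-pos : ∀ {p q} → p < q → 0ℚ < q - p
sub-pos {p} {q} p<q = subst (_< q - p) (+-inverseʳ p) (+-monoˡ-< (- p) p<q)

nonneg-sub : ∀ {p q} → 0ℚ ≤ q - p → p ≤ q
nonneg-sub {p} {q} h = subst₂ _≤_ (+-identityˡ p)
  (solve 2 (λ p q → (q :- p) :+ p := q) refl p q) (+-monoˡ-≤ p h)

∣∣-≤ : ∀ {p q} → p ≤ q → - p ≤ q → ∣ p ∣ ≤ q
∣∣-≤ {p} a b with ∣p∣≡p∨∣p∣≡-p p
... | inj₁ e = subst (_≤ _) (sym e) a
... | inj₂ e = subst (_≤ _) (sym e) b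

p≤∣p∣ : ∀ p → p ≤ ∣ p ∣
p≤∣p∣ p with ≤-total 0ℚ p
... | inj₁ h = ≤-reflexive (sym (0≤p⇒∣p∣≡p h))
... | inj₂ h = ≤-trans h (0≤∣p∣ p)

∣-∣-sym : ∀ p q → ∣ p - q ∣ ≡ ∣ q - p ∣
∣-∣-sym p q = trans
  (cong ∣_∣ (solve 2 (λ p q → p :- q := :- (q :- p)) refl p q)) (∣-p∣≡∣p∣ (q - p))

-- An inverse is passed as a number `a′` with `a′ * a ≡ 1ℚ`.

inv-nonneg : ∀ {a a′} → 0ℚ < a → a′ * a ≡ 1ℚ → 0ℚ ≤ a′
inv-nonneg {a} {a′} a>0 e = *-cancel a a>0
  (subst₂ _≤_ (sym (*-zeroˡ a)) (sym e) 0≤1)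

inv-antitone : ∀ {a a′ d d′} → 0ℚ < d → d ≤ a → a′ * a ≡ 1ℚ → d′ * d ≡ 1ℚ → a′ ≤ d′
inv-antitone {a} {a′} {d} {d′} d>0 d≤a ea ed = begin
  a′                ≡⟨ sym (*-identityʳ a′) ⟩
  a′ * 1ℚ           ≡⟨ cong (a′ *_) (sym ed) ⟩
  a′ * (d′ * d)     ≤⟨ *-monoˡ a′ (inv-nonneg {a} (<-≤-trans d>0 d≤a) ea)
                        (*-monoˡ {d} {a} d′ (inv-nonneg {d} d>0 ed) d≤a) ⟩
  a′ * (d′ * a)     ≡⟨ solve 3 (λ x y z → x :* (y :* z) := y :* (x :* z)) refl a′ d′ a ⟩
  d′ * (a′ * a)     ≡⟨ cong (d′ *_) ea ⟩
  d′ * 1ℚ           ≡⟨ *-identityʳ d′ ⟩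
  d′                ∎

inv-lipschitz : ∀ {a a′ b b′ d d′} → 0ℚ < d → d ≤ a → d ≤ b →
                a′ * a ≡ 1ℚ → b′ * b ≡ 1ℚ → d′ * d ≡ 1ℚ →
                ∣ a′ - b′ ∣ ≤ (d′ * d′) * ∣ a - b ∣
inv-lipschitz {a} {a′} {b} {b′} {d} {d′} d>0 d≤a d≤b ea eb ed = begin
  ∣ a′ - b′ ∣                     ≡⟨ cong ∣_∣ eq ⟩
  ∣ (a′ * b′) * (b - a) ∣         ≡⟨ ∣p*q∣≡∣p∣*∣q∣ (a′ * b′) (b - a) ⟩
  ∣ a′ * b′ ∣ * ∣ b - a ∣         ≡⟨ cong₂ _*_ (0≤p⇒∣p∣≡p (*-nonneg {a′} {b′} a′≥0 b′≥0)) (∣-∣-sym b a) ⟩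
  (a′ * b′) * ∣ a - b ∣           ≤⟨ *-monoʳ _ (0≤∣p∣ (a - b))
                                      (*-mono {a′} {d′} {b′} {d′} b′≥0 (inv-nonneg {d} d>0 ed)
                                        (inv-antitone {a} {a′} {d} d>0 d≤a ea ed)
                                        (inv-antitone {b} {b′} {d} d>0 d≤b eb ed)) ⟩
  (d′ * d′) * ∣ a - b ∣           ∎
  where
  a′≥0 : 0ℚ ≤ a′
  a′≥0 = inv-nonneg {a} (<-≤-trans d>0 d≤a) ea
  b′≥0 : 0ℚ ≤ b′
  b′≥0 = inv-nonneg {b} (<-≤-trans d>0 d≤b) eb
  eq : a′ - b′ ≡ (a′ * b′) * (b - a)
  eq = begin-equality
    a′ - b′                           ≡⟨ cong₂ _-_ (sym (*-identityʳ a′)) (sym (*-identityʳ b′)) ⟩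
    a′ * 1ℚ - b′ * 1ℚ                 ≡⟨ cong₂ (λ s t → a′ * s - b′ * t) (sym eb) (sym ea) ⟩
    a′ * (b′ * b) - b′ * (a′ * a)     ≡⟨ solve 4 (λ a a′ b b′ → a′ :* (b′ :* b) :- b′ :* (a′ :* a)
                                            := (a′ :* b′) :* (b :- a)) refl a a′ b b′ ⟩
    (a′ * b′) * (b - a)               ∎

reciprocal : ∀ p → 0ℚ < p → ∃[ q ] (0ℚ < q × q * p ≡ 1ℚ)
reciprocal p p>0 =
  (1/ p) {{>-nonZero p>0}} ,
  positive⁻¹ _ {{1/pos⇒pos p {{positive p>0}}}} ,
  *-inverseˡ p {{>-nonZero p>0}}

fromℕ : ℕ → ℚ
fromℕ n = + n / 1

toℚᵘ-fromℕ : ∀ n → toℚᵘ (fromℕ n) ℚᵘ.≃ ℚᵘ.mkℚᵘ (+ n) 0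
toℚᵘ-fromℕ n = toℚᵘ-fromℚᵘ (ℚᵘ.mkℚᵘ (+ n) 0)

fromℕ-suc : ∀ n → fromℕ (suc n) ≡ 1ℚ + fromℕ n
fromℕ-suc n = toℚᵘ-injective (ℚᵘₚ.≃-trans (toℚᵘ-fromℕ (suc n)) (ℚᵘₚ.≃-trans
  (ℚᵘ.*≡* (trans (ℤₚ.*-identityʳ (+ suc n)) (sym (trans (ℤₚ.*-identityʳ _)
     (cong (λ i → (+ 1) ℤ.+ i) (ℤₚ.*-identityʳ (+ n)))))))
  (ℚᵘₚ.≃-sym (ℚᵘₚ.≃-trans (toℚᵘ-homo-+ 1ℚ (fromℕ n))
     (ℚᵘₚ.+-congʳ (toℚᵘ 1ℚ) (toℚᵘ-fromℕ n))))))

fromℕ-mono : ∀ {m n} → m ℕ.≤ n → fromℕ m ≤ fromℕ n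
fromℕ-mono {m} {n} m≤n = toℚᵘ-cancel-≤
  (ℚᵘₚ.≤-respˡ-≃ (ℚᵘₚ.≃-sym (toℚᵘ-fromℕ m))
  (ℚᵘₚ.≤-respʳ-≃ (ℚᵘₚ.≃-sym (toℚᵘ-fromℕ n))
  (ℚᵘ.*≤* (ℤₚ.*-monoʳ-≤-nonNeg (+ 1) (ℤ.+≤+ m≤n)))))

fromℕ-nonneg : ∀ n → 0ℚ ≤ fromℕ n
fromℕ-nonneg n = fromℕ-mono {0} {n} z≤n

/-positive : ∀ a b .{{_ : ℕ.NonZero a}} .{{_ : ℕ.NonZero b}} → 0ℚ < + a / b
/-positive a b = positive⁻¹ _ {{normalize-pos a b}}

archimedean : ∀ q → 0ℚ < q → ∃[ N ] 1ℚ ≤ fromℕ N * q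
archimedean q q>0 with positive q>0
archimedean q@(mkℚ (+ suc k) d _) q>0 | _ = suc d , toℚᵘ-cancel-≤
  (ℚᵘₚ.≤-respʳ-≃ (ℚᵘₚ.≃-sym (ℚᵘₚ.≃-trans (toℚᵘ-homo-* (fromℕ (suc d)) q)
                                  (ℚᵘₚ.*-congʳ {toℚᵘ q} (toℚᵘ-fromℕ (suc d)))))
  (ℚᵘ.*≤* (ℤ.+≤+ le)))
  where
  le : 1 ℕ.* (1 ℕ.* suc d) ℕ.≤ (suc d ℕ.* suc k) ℕ.* 1
  le = ℕₚ.≤-trans (ℕₚ.≤-reflexive (trans (ℕₚ.*-identityˡ _) (ℕₚ.*-identityˡ _)))
       (ℕₚ.≤-trans (ℕₚ.m≤m*n (suc d) (suc k)) (ℕₚ.≤-reflexive (sym (ℕₚ.*-identityʳ _))))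

^-nonneg : ∀ {r} n → 0ℚ ≤ r → 0ℚ ≤ r ^ n
^-nonneg zero    r≥0 = 0≤1
^-nonneg {r} (suc n) r≥0 = *-nonneg {r} r≥0 (^-nonneg n r≥0)

^-mono : ∀ {r s} n → 0ℚ ≤ r → r ≤ s → r ^ n ≤ s ^ n
^-mono zero    r≥0 r≤s = ≤-refl
^-mono {r} {s} (suc n) r≥0 r≤s = *-mono {r} {s} {r ^ n} {s ^ n} (^-nonneg n r≥0) (≤-trans r≥0 r≤s) r≤s (^-mono n r≥0 r≤s)

^-shrink : ∀ {r} m n → 0ℚ ≤ r → r ≤ 1ℚ → m ℕ.≤ n → r ^ n ≤ r ^ m
^-shrink {r} zero zero r≥0 r≤1 z≤n = ≤-refl
^-shrink {r} zero (suc n) r≥0 r≤1 z≤n =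
  subst (r * r ^ n ≤_) (*-identityˡ 1ℚ)
    (*-mono {r} {1ℚ} {r ^ n} {1ℚ} (^-nonneg n r≥0) 0≤1 r≤1 (^-shrink zero n r≥0 r≤1 z≤n))
^-shrink {r} (suc m) (suc n) r≥0 r≤1 (s≤s h) = *-monoˡ {r ^ n} {r ^ m} r r≥0 (^-shrink m n r≥0 r≤1 h)

^-abs : ∀ p n → ∣ p ^ n ∣ ≡ ∣ p ∣ ^ n
^-abs p zero    = refl
^-abs p (suc n) = trans (∣p*q∣≡∣p∣*∣q∣ p (p ^ n)) (cong (∣ p ∣ *_) (^-abs p n))

^-abs-≤ : ∀ {p r} n → ∣ p ∣ ≤ r → ∣ p ^ n ∣ ≤ r ^ n
^-abs-≤ {p} {r} n h = subst (_≤ r ^ n) (sym (^-abs p n)) (^-mono n (0≤∣p∣ p) h)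

^-lipschitz : ∀ {w v r} n → 0ℚ ≤ r → ∣ w ∣ ≤ r → ∣ v ∣ ≤ r →
              ∣ w ^ suc n - v ^ suc n ∣ ≤ (fromℕ (suc n) * r ^ n) * ∣ w - v ∣
^-lipschitz {w} {v} {r} zero r≥0 hw hv = ≤-reflexive
  (trans (cong ∣_∣ (solve 2 (λ w v → w :* con 1ℚ :- v :* con 1ℚ := w :- v) refl w v))
         (sym (*-identityˡ _)))
^-lipschitz {w} {v} {r} (suc n) r≥0 hw hv = begin
  ∣ w * a - v * b ∣
    ≡⟨ cong ∣_∣ (solve 4 (λ w v a b → w :* a :- v :* b := w :* (a :- b) :+ b :* (w :- v))
         refl w v a b) ⟩
  ∣ w * (a - b) + b * (w - v) ∣
    ≤⟨ ∣p+q∣≤∣p∣+∣q∣ (w * (a - b)) (b * (w - v)) ⟩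
  ∣ w * (a - b) ∣ + ∣ b * (w - v) ∣
    ≡⟨ cong₂ _+_ (∣p*q∣≡∣p∣*∣q∣ w (a - b)) (∣p*q∣≡∣p∣*∣q∣ b (w - v)) ⟩
  ∣ w ∣ * ∣ a - b ∣ + ∣ b ∣ * D
    ≤⟨ +-mono-≤ (*-mono {∣ w ∣} {r} {∣ a - b ∣} (0≤∣p∣ (a - b)) r≥0 hw (^-lipschitz n r≥0 hw hv))
                (*-monoʳ {∣ b ∣} {r ^ suc n} D (0≤∣p∣ (w - v)) (^-abs-≤ {v} (suc n) hv)) ⟩
  r * ((fromℕ (suc n) * r ^ n) * D) + (r * r ^ n) * D
    ≡⟨ solve 4 (λ r f q D → r :* ((f :* q) :* D) :+ (r :* q) :* D
                 := ((con 1ℚ :+ f) :* (r :* q)) :* D) refl r (fromℕ (suc n)) (r ^ n) D ⟩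
  ((1ℚ + fromℕ (suc n)) * (r * r ^ n)) * D
    ≡⟨ cong (λ t → (t * (r * r ^ n)) * D) (sym (fromℕ-suc (suc n))) ⟩
  (fromℕ (suc (suc n)) * (r * r ^ n)) * D ∎
  where
  a b D : ℚ
  a = w ^ suc n
  b = v ^ suc n
  D = ∣ w - v ∣

bernoulli : ∀ r n → 0ℚ ≤ r → r ≤ 1ℚ → r ^ n * (1ℚ + fromℕ n * (1ℚ - r)) ≤ 1ℚ
bernoulli r zero r≥0 r≤1 = ≤-reflexive
  (solve 1 (λ r → con 1ℚ :* (con 1ℚ :+ con 0ℚ :* (con 1ℚ :- r)) := con 1ℚ) refl r)
bernoulli r (suc n) r≥0 r≤1 = ≤-trans (begin
  (r * r ^ n) * (1ℚ + fromℕ (suc n) * c)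
    ≡⟨ cong (λ t → (r * r ^ n) * (1ℚ + t * c)) (fromℕ-suc n) ⟩
  (r * r ^ n) * (1ℚ + (1ℚ + fromℕ n) * c)
    ≤⟨ p≤p+q _ (r ^ n * ((1ℚ + fromℕ n) * (c * c))) (*-nonneg {r ^ n} (^-nonneg n r≥0)
        (*-nonneg {1ℚ + fromℕ n} {c * c} (+-nonneg {1ℚ} 0≤1 (fromℕ-nonneg n))
          (*-nonneg {c} {c} c≥0 c≥0))) ⟩
  (r * r ^ n) * (1ℚ + (1ℚ + fromℕ n) * c) + r ^ n * ((1ℚ + fromℕ n) * (c * c))
    ≡⟨ solve 3 (λ r q f → (r :* q) :* (con 1ℚ :+ (con 1ℚ :+ f) :* (con 1ℚ :- r))
                 :+ q :* ((con 1ℚ :+ f) :* ((con 1ℚ :- r) :* (con 1ℚ :- r)))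
                 := q :* (con 1ℚ :+ f :* (con 1ℚ :- r))) refl r (r ^ n) (fromℕ n) ⟩
  r ^ n * (1ℚ + fromℕ n * c) ∎) (bernoulli r n r≥0 r≤1)
  where
  c : ℚ
  c = 1ℚ - r
  c≥0 : 0ℚ ≤ c
  c≥0 = sub-nonneg r≤1

Cauchy : (ℕ → ℚ) → Set
Cauchy x = ∀ ε → 0ℚ < ε → ∃[ N ] ∀ m n → N ℕ.≤ m → N ℕ.≤ n → ∣ x m - x n ∣ < ε

Cauchy-const : ∀ q → Cauchy (λ _ → q)
Cauchy-const q ε ε>0 = 0 , λ _ _ _ _ →
  subst (λ t → ∣ t ∣ < ε) (sym (+-inverseʳ q)) ε>0

Cauchy-shift : ∀ {x} k → Cauchy x → Cauchy (λ n → x (k ℕ.+ n))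
Cauchy-shift k c ε ε>0 with c ε ε>0
... | N , h = N , λ m n a b →
  h (k ℕ.+ m) (k ℕ.+ n) (ℕₚ.≤-trans a (ℕₚ.m≤n+m m k)) (ℕₚ.≤-trans b (ℕₚ.m≤n+m n k))

Cauchy-dominated : ∀ {x y z} K N₀ → 0ℚ < K → Cauchy x → Cauchy y →
  (∀ m n → N₀ ℕ.≤ m → N₀ ℕ.≤ n →
     ∣ z m - z n ∣ ≤ K * (∣ x m - x n ∣ + ∣ y m - y n ∣)) →
  Cauchy z
Cauchy-dominated {x} {y} {z} K N₀ K>0 cx cy h ε ε>0
  with reciprocal (2ℚ * K) (*-pos {2ℚ} {K} 0<2 K>0)
... | k , k>0 , ek with cx (ε * k) (*-pos {ε} {k} ε>0 k>0) | cy (ε * k) (*-pos {ε} {k} ε>0 k>0)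
... | N₁ , h₁ | N₂ , h₂ = N₀ ℕ.+ (N₁ ℕ.+ N₂) , λ m n a b →
  let le₀ : ∀ {i} → N₀ ℕ.+ (N₁ ℕ.+ N₂) ℕ.≤ i → N₀ ℕ.≤ i
      le₀ = ℕₚ.≤-trans (ℕₚ.m≤m+n N₀ _)
      le₁ : ∀ {i} → N₀ ℕ.+ (N₁ ℕ.+ N₂) ℕ.≤ i → N₁ ℕ.≤ i
      le₁ = ℕₚ.≤-trans (ℕₚ.≤-trans (ℕₚ.m≤m+n N₁ N₂) (ℕₚ.m≤n+m _ N₀))
      le₂ : ∀ {i} → N₀ ℕ.+ (N₁ ℕ.+ N₂) ℕ.≤ i → N₂ ℕ.≤ i
      le₂ = ℕₚ.≤-trans (ℕₚ.≤-trans (ℕₚ.m≤n+m N₂ N₁) (ℕₚ.m≤n+m _ N₀))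
  in begin-strict
  ∣ z m - z n ∣
    ≤⟨ h m n (le₀ a) (le₀ b) ⟩
  K * (∣ x m - x n ∣ + ∣ y m - y n ∣)
    <⟨ *-monoʳ-<-pos K {{positive K>0}} {∣ x m - x n ∣ + ∣ y m - y n ∣} {ε * k + ε * k}
         (+-mono-< {∣ x m - x n ∣} {ε * k} {∣ y m - y n ∣} {ε * k} (h₁ m n (le₁ a) (le₁ b)) (h₂ m n (le₂ a) (le₂ b))) ⟩
  K * (ε * k + ε * k)
    ≡⟨ solve 3 (λ K e k → K :* (e :* k :+ e :* k) := e :* (k :* (con 2ℚ :* K))) refl K ε k ⟩
  ε * (k * (2ℚ * K))
    ≡⟨ trans (cong (ε *_) ek) (*-identityʳ ε) ⟩
  ε ∎

Cauchy-bounded : ∀ {x} → Cauchy x → ∃[ B ] (0ℚ < B × ∃[ N ] ∀ n → N ℕ.≤ n → ∣ x n ∣ ≤ B)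
Cauchy-bounded {x} c with c 1ℚ 0<1
... | N , h = 1ℚ + ∣ x N ∣ , <-≤-trans 0<1 (p≤p+q 1ℚ ∣ x N ∣ (0≤∣p∣ (x N))) , N , λ n N≤n → begin
  ∣ x n ∣                     ≡⟨ cong ∣_∣ (solve 2 (λ a b → a := (a :- b) :+ b) refl (x n) (x N)) ⟩
  ∣ (x n - x N) + x N ∣       ≤⟨ ∣p+q∣≤∣p∣+∣q∣ (x n - x N) (x N) ⟩
  ∣ x n - x N ∣ + ∣ x N ∣     ≤⟨ +-monoˡ-≤ ∣ x N ∣ (<⇒≤ (h n N N≤n ℕₚ.≤-refl)) ⟩
  1ℚ + ∣ x N ∣                ∎

Cauchy-+ : ∀ {x y} → Cauchy x → Cauchy y → Cauchy (λ n → x n + y n)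
Cauchy-+ {x} {y} cx cy = Cauchy-dominated {x} {y} {λ n → x n + y n} 1ℚ 0 0<1 cx cy λ m n _ _ → begin
  ∣ (x m + y m) - (x n + y n) ∣
    ≡⟨ cong ∣_∣ (solve 4 (λ a b c d → (a :+ b) :- (c :+ d) := (a :- c) :+ (b :- d))
         refl (x m) (y m) (x n) (y n)) ⟩
  ∣ (x m - x n) + (y m - y n) ∣
    ≤⟨ ∣p+q∣≤∣p∣+∣q∣ (x m - x n) (y m - y n) ⟩
  ∣ x m - x n ∣ + ∣ y m - y n ∣
    ≡⟨ sym (*-identityˡ _) ⟩
  1ℚ * (∣ x m - x n ∣ + ∣ y m - y n ∣) ∎

product-difference : ∀ {B C} a b c d → 0ℚ < B → 0ℚ < C → ∣ b ∣ ≤ C → ∣ c ∣ ≤ B →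
                     ∣ a * b - c * d ∣ ≤ (B + C) * (∣ a - c ∣ + ∣ b - d ∣)
product-difference {B} {C} a b c d B>0 C>0 hb hc = begin
  ∣ a * b - c * d ∣
    ≡⟨ cong ∣_∣ (solve 4 (λ a b c d → a :* b :- c :* d := (a :- c) :* b :+ c :* (b :- d))
         refl a b c d) ⟩
  ∣ (a - c) * b + c * (b - d) ∣
    ≤⟨ ∣p+q∣≤∣p∣+∣q∣ ((a - c) * b) (c * (b - d)) ⟩
  ∣ (a - c) * b ∣ + ∣ c * (b - d) ∣
    ≡⟨ cong₂ _+_ (∣p*q∣≡∣p∣*∣q∣ (a - c) b) (∣p*q∣≡∣p∣*∣q∣ c (b - d)) ⟩
  P * ∣ b ∣ + ∣ c ∣ * Q
    ≤⟨ +-mono-≤ {P * ∣ b ∣} {P * C} {∣ c ∣ * Q} {B * Q}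
         (*-monoˡ {∣ b ∣} {C} P P≥0 hb) (*-monoʳ {∣ c ∣} {B} Q Q≥0 hc) ⟩
  P * C + B * Q
    ≤⟨ p≤p+q (P * C + B * Q) (B * P + C * Q) (+-nonneg {B * P} {C * Q}
         (*-nonneg {B} {P} (<⇒≤ B>0) P≥0) (*-nonneg {C} {Q} (<⇒≤ C>0) Q≥0)) ⟩
  (P * C + B * Q) + (B * P + C * Q)
    ≡⟨ solve 4 (λ B C P Q → (P :* C :+ B :* Q) :+ (B :* P :+ C :* Q)
                 := (B :+ C) :* (P :+ Q)) refl B C P Q ⟩
  (B + C) * (P + Q) ∎
  where
  P Q : ℚ
  P = ∣ a - c ∣
  Q = ∣ b - d ∣
  P≥0 : 0ℚ ≤ P
  P≥0 = 0≤∣p∣ (a - c)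
  Q≥0 : 0ℚ ≤ Q
  Q≥0 = 0≤∣p∣ (b - d)

Cauchy-* : ∀ {x y} → Cauchy x → Cauchy y → Cauchy (λ n → x n * y n)
Cauchy-* {x} {y} cx cy =
  let (B , B>0 , M , hB) = Cauchy-bounded {x} cx
      (C , C>0 , N , hC) = Cauchy-bounded {y} cy
  in Cauchy-dominated {x} {y} {λ n → x n * y n} (B + C) (M ℕ.+ N) (+-pos {B} {C} B>0 C>0) cx cy
    λ m n a b → product-difference {B} {C} (x m) (y m) (x n) (y n) B>0 C>0
      (hC m (ℕₚ.≤-trans (ℕₚ.m≤n+m N M) a)) (hB n (ℕₚ.≤-trans (ℕₚ.m≤m+n M N) b))

^-null : ∀ {r} → 0ℚ ≤ r → r < 1ℚ → ∀ ε → 0ℚ < ε → ∃[ N ] r ^ N ≤ ε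
^-null {r} r≥0 r<1 ε ε>0 = N , (begin
  q                           ≡⟨ sym (*-identityʳ q) ⟩
  q * 1ℚ                      ≤⟨ *-monoˡ {1ℚ} {fromℕ N * (c * ε)} q q≥0 hN ⟩
  q * (fromℕ N * (c * ε))     ≡⟨ solve 4 (λ q f c e → q :* (f :* (c :* e)) := (q :* (f :* c)) :* e)
                                   refl q (fromℕ N) c ε ⟩
  (q * (fromℕ N * c)) * ε     ≤⟨ *-monoʳ {q * (fromℕ N * c)} {1ℚ} ε (<⇒≤ ε>0) (≤-trans
                                   (*-monoˡ {fromℕ N * c} {1ℚ + fromℕ N * c} q q≥0
                                     (subst (_≤ 1ℚ + fromℕ N * c) (+-identityˡ (fromℕ N * c))
                                       (+-monoˡ-≤ (fromℕ N * c) {0ℚ} {1ℚ} 0≤1)))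
                                   (bernoulli r N r≥0 (<⇒≤ r<1))) ⟩
  1ℚ * ε                      ≡⟨ *-identityˡ ε ⟩
  ε                           ∎)
  where
  c : ℚ
  c = 1ℚ - r
  arch : ∃[ N ] 1ℚ ≤ fromℕ N * (c * ε)
  arch = archimedean (c * ε) (*-pos {c} {ε} (sub-pos r<1) ε>0)
  N : ℕ
  N = proj₁ arch
  hN : 1ℚ ≤ fromℕ N * (c * ε)
  hN = proj₂ arch
  q : ℚ
  q = r ^ N
  q≥0 : 0ℚ ≤ q
  q≥0 = ^-nonneg N r≥0

^-difference : ∀ {r η} N m n → 0ℚ ≤ r → r ≤ 1ℚ → N ℕ.≤ m → r ^ N ≤ η → r ^ m - r ^ n ≤ η
^-difference {r} {η} N m n r≥0 r≤1 N≤m hN = begin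
  r ^ m - r ^ n   ≤⟨ nonneg-sub {r ^ m - r ^ n} {r ^ m} (subst (0ℚ ≤_)
                       (solve 2 (λ a b → b := a :- (a :- b)) refl (r ^ m) (r ^ n))
                       (^-nonneg n r≥0)) ⟩
  r ^ m           ≤⟨ ^-shrink N m r≥0 r≤1 N≤m ⟩
  r ^ N           ≤⟨ hN ⟩
  η               ∎

Cauchy-^ : ∀ {r} → 0ℚ ≤ r → r < 1ℚ → Cauchy (r ^_)
Cauchy-^ {r} r≥0 r<1 ε ε>0 =
  let (η , η>0 , η<ε) = <-dense ε>0
      (N , hN) = ^-null {r} r≥0 r<1 η η>0
  in N , λ m n a b → ≤-<-trans
    (∣∣-≤ (^-difference N m n r≥0 (<⇒≤ r<1) a hN)
      (subst (_≤ η) (solve 2 (λ a b → b :- a := :- (a :- b)) refl (r ^ m) (r ^ n))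
        (^-difference N n m r≥0 (<⇒≤ r<1) b hN))) η<ε

Cauchy-lipschitz : ∀ {x z} K → 0ℚ < K → Cauchy x →
  (∀ m n → ∣ z m - z n ∣ ≤ K * ∣ x m - x n ∣) → Cauchy z
Cauchy-lipschitz {x} {z} K K>0 cx h =
  Cauchy-dominated {x} {λ _ → 0ℚ} {z} K 0 K>0 cx (Cauchy-const 0ℚ) λ m n _ _ →
    ≤-trans (h m n) (*-monoˡ {∣ x m - x n ∣} {∣ x m - x n ∣ + ∣ 0ℚ - 0ℚ ∣} K (<⇒≤ K>0)
      (p≤p+q ∣ x m - x n ∣ ∣ 0ℚ - 0ℚ ∣ (0≤∣p∣ (0ℚ - 0ℚ))))

-- Real numbers, represented by Cauchy sequences of rationals.  Distinct
-- sequences may represent the same real; the order below does not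
-- distinguish such representatives.

record ℝ : Set where
  constructor real
  field
    seq    : ℕ → ℚ
    cauchy : Cauchy seq

open ℝ public

infix  4 _<ℝ_
infixl 6 _+ℝ_
infixl 7 _*ℝ_ _/ℝ_[_]

⌜_⌝ : ℚ → ℝ
⌜ q ⌝ = real (λ _ → q) (Cauchy-const q)

0ℝ 1ℝ : ℝ
0ℝ = ⌜ 0ℚ ⌝
1ℝ = ⌜ 1ℚ ⌝

_+ℝ_ : ℝ → ℝ → ℝ
x +ℝ y = real (λ n → seq x n + seq y n) (Cauchy-+ {seq x} {seq y} (cauchy x) (cauchy y))

_*ℝ_ : ℝ → ℝ → ℝ
x *ℝ y = real (λ n → seq x n * seq y n) (Cauchy-* {seq x} {seq y} (cauchy x) (cauchy y))

_<ℝ_ : ℝ → ℝ → Set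
x <ℝ y = Σ[ ε ∈ ℚ ] (0ℚ < ε × Σ[ N ∈ ℕ ] (∀ n → N ℕ.≤ n → seq x n + ε ≤ seq y n))

-- The reciprocal and the logarithm of a positive real are computed from the
-- tail of its sequence on which the terms exceed a positive rational.

module Tail (x : ℝ) (x>0 : 0ℝ <ℝ x) where

  bound : ℚ
  bound = proj₁ x>0

  bound>0 : 0ℚ < bound
  bound>0 = proj₁ (proj₂ x>0)

  cutoff : ℕ
  cutoff = proj₁ (proj₂ (proj₂ x>0))

  tail : ℕ → ℚ
  tail n = seq x (cutoff ℕ.+ n)

  tail-bound : ∀ n → bound ≤ tail n
  tail-bound n = subst (_≤ tail n) (+-identityˡ bound)
    (proj₂ (proj₂ (proj₂ x>0)) (cutoff ℕ.+ n) (ℕₚ.m≤m+n cutoff n))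

  tail>0 : ∀ n → 0ℚ < tail n
  tail>0 n = <-≤-trans bound>0 (tail-bound n)

  tail-cauchy : Cauchy tail
  tail-cauchy = Cauchy-shift {seq x} cutoff (cauchy x)

recip : (x : ℝ) → 0ℝ <ℝ x → ℝ
recip x x>0 = real inv (Cauchy-lipschitz {tail} {inv} (d * d) (*-pos {d} {d} d>0 d>0) tail-cauchy
  λ m n → inv-lipschitz {tail m} {inv m} {tail n} {inv n} {bound} {d} bound>0
    (tail-bound m) (tail-bound n) (inv-eq m) (inv-eq n) d-eq)
  where
  open Tail x x>0
  inv : ℕ → ℚ
  inv n = (1/ tail n) {{>-nonZero (tail>0 n)}}
  inv-eq : ∀ n → inv n * tail n ≡ 1ℚ
  inv-eq n = *-inverseˡ (tail n) {{>-nonZero (tail>0 n)}}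
  d : ℚ
  d = proj₁ (reciprocal bound bound>0)
  d>0 : 0ℚ < d
  d>0 = proj₁ (proj₂ (reciprocal bound bound>0))
  d-eq : d * bound ≡ 1ℚ
  d-eq = proj₂ (proj₂ (reciprocal bound bound>0))

_/ℝ_[_] : (x y : ℝ) → 0ℝ <ℝ y → ℝ
x /ℝ y [ y>0 ] = x *ℝ recip y y>0

-- Partial sums of artanh z = z + z³/3 + z⁵/5 + ⋯

odd-recip : ℕ → ℚ
odd-recip k = + 1 / suc (2 ℕ.* k)

artanh-term : ℕ → ℚ → ℚ
artanh-term k z = z ^ suc (2 ℕ.* k) * odd-recip k

artanh-sum : ℕ → ℚ → ℚ
artanh-sum zero    z = 0ℚ
artanh-sum (suc k) z = artanh-sum k z + artanh-term k z

odd-recip-inverse : ∀ k → fromℕ (suc (2 ℕ.* k)) * odd-recip k ≡ 1ℚ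
odd-recip-inverse k = toℚᵘ-injective (ℚᵘₚ.≃-trans (toℚᵘ-homo-* (fromℕ m) (odd-recip k))
  (ℚᵘₚ.≃-trans (ℚᵘₚ.*-cong (toℚᵘ-fromℕ m) (toℚᵘ-fromℚᵘ (ℚᵘ.mkℚᵘ (+ 1) (2 ℕ.* k))))
    (ℚᵘ.*≡* (cong +_ (trans (ℕₚ.*-identityʳ _) (trans (ℕₚ.*-identityʳ m)
      (sym (trans (ℕₚ.*-identityˡ _) (ℕₚ.*-identityˡ m)))))))))
  where
  m : ℕ
  m = suc (2 ℕ.* k)

odd-recip-pos : ∀ k → 0ℚ < odd-recip k
odd-recip-pos k = /-positive 1 (suc (2 ℕ.* k))

odd-recip-nonneg : ∀ k → 0ℚ ≤ odd-recip k
odd-recip-nonneg k = <⇒≤ (odd-recip-pos k)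

odd-recip-≤1 : ∀ k → odd-recip k ≤ 1ℚ
odd-recip-≤1 k = subst₂ _≤_ (*-identityˡ (odd-recip k)) (odd-recip-inverse k)
  (*-monoʳ {1ℚ} {fromℕ (suc (2 ℕ.* k))} (odd-recip k) (odd-recip-nonneg k)
    (fromℕ-mono {1} {suc (2 ℕ.* k)} (s≤s z≤n)))

k≤2k : ∀ k → k ℕ.≤ 2 ℕ.* k
k≤2k k = ℕₚ.m≤m+n k _

artanh-term-abs : ∀ {r} k z → 0ℚ ≤ r → r ≤ 1ℚ → ∣ z ∣ ≤ r → ∣ artanh-term k z ∣ ≤ r ^ k
artanh-term-abs {r} k z r≥0 r≤1 hz = begin
  ∣ z ^ m * i ∣         ≡⟨ ∣p*q∣≡∣p∣*∣q∣ (z ^ m) i ⟩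
  ∣ z ^ m ∣ * ∣ i ∣     ≡⟨ cong (∣ z ^ m ∣ *_) (0≤p⇒∣p∣≡p (odd-recip-nonneg k)) ⟩
  ∣ z ^ m ∣ * i         ≤⟨ *-mono {∣ z ^ m ∣} {r ^ k} {i} {1ℚ} (odd-recip-nonneg k) (^-nonneg k r≥0)
                             (≤-trans (^-abs-≤ {z} m hz)
                               (^-shrink k m r≥0 r≤1 (ℕₚ.m≤n⇒m≤1+n (k≤2k k))))
                             (odd-recip-≤1 k) ⟩
  r ^ k * 1ℚ            ≡⟨ *-identityʳ (r ^ k) ⟩
  r ^ k                 ∎
  where
  m : ℕ
  m = suc (2 ℕ.* k)
  i : ℚ
  i = odd-recip k

artanh-term-lipschitz : ∀ {r} k w v → 0ℚ ≤ r → r ≤ 1ℚ → ∣ w ∣ ≤ r → ∣ v ∣ ≤ r →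
  ∣ artanh-term k w - artanh-term k v ∣ ≤ r ^ k * ∣ w - v ∣
artanh-term-lipschitz {r} k w v r≥0 r≤1 hw hv = begin
  ∣ a * i - b * i ∣
    ≡⟨ cong ∣_∣ (solve 3 (λ a b i → a :* i :- b :* i := (a :- b) :* i) refl a b i) ⟩
  ∣ (a - b) * i ∣
    ≡⟨ ∣p*q∣≡∣p∣*∣q∣ (a - b) i ⟩
  ∣ a - b ∣ * ∣ i ∣
    ≡⟨ cong (∣ a - b ∣ *_) (0≤p⇒∣p∣≡p (odd-recip-nonneg k)) ⟩
  ∣ a - b ∣ * i
    ≤⟨ *-monoʳ {∣ a - b ∣} {(f * r ^ (2 ℕ.* k)) * D} i (odd-recip-nonneg k)
         (^-lipschitz {w} {v} {r} (2 ℕ.* k) r≥0 hw hv) ⟩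
  ((f * r ^ (2 ℕ.* k)) * D) * i
    ≡⟨ solve 4 (λ f q D i → ((f :* q) :* D) :* i := (f :* i) :* (q :* D))
         refl f (r ^ (2 ℕ.* k)) D i ⟩
  (f * i) * (r ^ (2 ℕ.* k) * D)
    ≡⟨ trans (cong (_* (r ^ (2 ℕ.* k) * D)) (odd-recip-inverse k)) (*-identityˡ _) ⟩
  r ^ (2 ℕ.* k) * D
    ≤⟨ *-monoʳ {r ^ (2 ℕ.* k)} {r ^ k} D (0≤∣p∣ (w - v)) (^-shrink k (2 ℕ.* k) r≥0 r≤1 (k≤2k k)) ⟩
  r ^ k * D ∎
  where
  a b i f D : ℚ
  a = w ^ suc (2 ℕ.* k)
  b = v ^ suc (2 ℕ.* k)
  i = odd-recip k
  f = fromℕ (suc (2 ℕ.* k))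
  D = ∣ w - v ∣

module ArtanhBounds {r K : ℚ} (r≥0 : 0ℚ ≤ r) (r≤1 : r ≤ 1ℚ) (K≥0 : 0ℚ ≤ K)
                    (K-eq : K * (1ℚ - r) ≡ 1ℚ) where

  lipschitz : ∀ n w v → ∣ w ∣ ≤ r → ∣ v ∣ ≤ r →
    ∣ artanh-sum n w - artanh-sum n v ∣ ≤ ((1ℚ - r ^ n) * K) * ∣ w - v ∣
  lipschitz zero w v hw hv = ≤-reflexive
    (sym (solve 2 (λ K D → ((con 1ℚ :- con 1ℚ) :* K) :* D := con 0ℚ) refl K ∣ w - v ∣))
  lipschitz (suc n) w v hw hv = begin
    ∣ (a + s) - (b + t) ∣
      ≡⟨ cong ∣_∣ (solve 4 (λ a s b t → (a :+ s) :- (b :+ t) := (a :- b) :+ (s :- t))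
           refl a s b t) ⟩
    ∣ (a - b) + (s - t) ∣
      ≤⟨ ∣p+q∣≤∣p∣+∣q∣ (a - b) (s - t) ⟩
    ∣ a - b ∣ + ∣ s - t ∣
      ≤⟨ +-mono-≤ {∣ a - b ∣} {((1ℚ - q) * K) * D} {∣ s - t ∣} {q * D}
           (lipschitz n w v hw hv) (artanh-term-lipschitz n w v r≥0 r≤1 hw hv) ⟩
    ((1ℚ - q) * K) * D + q * D
      ≡⟨ cong (λ u → ((1ℚ - q) * K) * D + u * D)
           (trans (sym (*-identityʳ q)) (cong (q *_) (sym K-eq))) ⟩
    ((1ℚ - q) * K) * D + (q * (K * (1ℚ - r))) * D
      ≡⟨ solve 4 (λ q K r D → ((con 1ℚ :- q) :* K) :* D :+ (q :* (K :* (con 1ℚ :- r))) :* D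
                   := ((con 1ℚ :- r :* q) :* K) :* D) refl q K r D ⟩
    ((1ℚ - r * q) * K) * D ∎
    where
    a b s t q D : ℚ
    a = artanh-sum n w
    b = artanh-sum n v
    s = artanh-term n w
    t = artanh-term n v
    q = r ^ n
    D = ∣ w - v ∣

  tail-sum : ∀ d n w → ∣ w ∣ ≤ r →
    ∣ artanh-sum (d ℕ.+ n) w - artanh-sum n w ∣ ≤ (r ^ n - r ^ (d ℕ.+ n)) * K
  tail-sum zero n w hw = ≤-reflexive (trans (cong ∣_∣ (+-inverseʳ (artanh-sum n w)))
    (sym (solve 2 (λ q K → (q :- q) :* K := con 0ℚ) refl (r ^ n) K)))
  tail-sum (suc d) n w hw = begin
    ∣ (a + t) - b ∣
      ≡⟨ cong ∣_∣ (solve 3 (λ a t b → (a :+ t) :- b := (a :- b) :+ t) refl a t b) ⟩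
    ∣ (a - b) + t ∣
      ≤⟨ ∣p+q∣≤∣p∣+∣q∣ (a - b) t ⟩
    ∣ a - b ∣ + ∣ t ∣
      ≤⟨ +-mono-≤ {∣ a - b ∣} {(r ^ n - q) * K} {∣ t ∣} {q}
           (tail-sum d n w hw) (artanh-term-abs (d ℕ.+ n) w r≥0 r≤1 hw) ⟩
    (r ^ n - q) * K + q
      ≡⟨ cong (λ u → (r ^ n - q) * K + u) (trans (sym (*-identityʳ q)) (cong (q *_) (sym K-eq))) ⟩
    (r ^ n - q) * K + q * (K * (1ℚ - r))
      ≡⟨ solve 4 (λ p q K r → (p :- q) :* K :+ q :* (K :* (con 1ℚ :- r))
                   := (p :- r :* q) :* K) refl (r ^ n) q K r ⟩
    (r ^ n - r * q) * K ∎
    where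
    a b t q : ℚ
    a = artanh-sum (d ℕ.+ n) w
    b = artanh-sum n w
    t = artanh-term (d ℕ.+ n) w
    q = r ^ (d ℕ.+ n)

  difference-+ : ∀ d n w v → ∣ w ∣ ≤ r → ∣ v ∣ ≤ r →
    ∣ artanh-sum (d ℕ.+ n) w - artanh-sum n v ∣ ≤
    K * (∣ w - v ∣ + ∣ r ^ (d ℕ.+ n) - r ^ n ∣)
  difference-+ d n w v hw hv = begin
    ∣ a - c ∣
      ≡⟨ cong ∣_∣ (solve 3 (λ a b c → a :- c := (b :- c) :+ (a :- b)) refl a b c) ⟩
    ∣ (b - c) + (a - b) ∣
      ≤⟨ ∣p+q∣≤∣p∣+∣q∣ (b - c) (a - b) ⟩
    ∣ b - c ∣ + ∣ a - b ∣
      ≤⟨ +-mono-≤ {∣ b - c ∣} {((1ℚ - p) * K) * D} {∣ a - b ∣} {(p - q) * K}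
           (lipschitz n w v hw hv) (tail-sum d n w hw) ⟩
    ((1ℚ - p) * K) * D + (p - q) * K
      ≤⟨ +-mono-≤ {((1ℚ - p) * K) * D} {K * D} {(p - q) * K} {K * E}
           (nonneg-sub {((1ℚ - p) * K) * D} {K * D} (subst (0ℚ ≤_)
              (solve 3 (λ p K D → (p :* K) :* D := K :* D :- ((con 1ℚ :- p) :* K) :* D)
                refl p K D)
              (*-nonneg {p * K} {D} (*-nonneg {p} {K} (^-nonneg n r≥0) K≥0) (0≤∣p∣ (w - v)))))
           (subst (_≤ K * E) (*-comm K (p - q)) (*-monoˡ {p - q} {E} K K≥0
              (subst (p - q ≤_) (∣-∣-sym p q) (p≤∣p∣ (p - q))))) ⟩
    K * D + K * E
      ≡⟨ sym (*-distribˡ-+ K D E) ⟩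
    K * (D + E) ∎
    where
    a b c p q D E : ℚ
    a = artanh-sum (d ℕ.+ n) w
    b = artanh-sum n w
    c = artanh-sum n v
    p = r ^ n
    q = r ^ (d ℕ.+ n)
    D = ∣ w - v ∣
    E = ∣ q - p ∣

  difference-≥ : ∀ m n w v → n ℕ.≤ m → ∣ w ∣ ≤ r → ∣ v ∣ ≤ r →
    ∣ artanh-sum m w - artanh-sum n v ∣ ≤ K * (∣ w - v ∣ + ∣ r ^ m - r ^ n ∣)
  difference-≥ m n w v n≤m hw hv = subst
    (λ i → ∣ artanh-sum i w - artanh-sum n v ∣ ≤ K * (∣ w - v ∣ + ∣ r ^ i - r ^ n ∣))
    (ℕₚ.m∸n+n≡m n≤m) (difference-+ (m ℕ.∸ n) n w v hw hv)

  difference : ∀ m n w v → ∣ w ∣ ≤ r → ∣ v ∣ ≤ r →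
    ∣ artanh-sum m w - artanh-sum n v ∣ ≤ K * (∣ w - v ∣ + ∣ r ^ m - r ^ n ∣)
  difference m n w v hw hv = by-cases (ℕₚ.≤-total n m)
    where
    by-cases : n ℕ.≤ m ⊎ m ℕ.≤ n →
      ∣ artanh-sum m w - artanh-sum n v ∣ ≤ K * (∣ w - v ∣ + ∣ r ^ m - r ^ n ∣)
    by-cases (inj₁ n≤m) = difference-≥ m n w v n≤m hw hv
    by-cases (inj₂ m≤n) = subst₂ _≤_ (∣-∣-sym (artanh-sum n v) (artanh-sum m w))
      (cong₂ (λ s t → K * (s + t)) (∣-∣-sym v w) (∣-∣-sym (r ^ n) (r ^ m)))
      (difference-≥ n m v w m≤n hv hw)

-- The natural logarithm, log x = 2 artanh ((x - 1) / (x + 1)) for x > 0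

1+pos : ∀ {a} → 0ℚ < a → 0ℚ < a + 1ℚ
1+pos {a} a>0 = +-pos {a} {1ℚ} a>0 0<1

cayley : (a : ℚ) → .(0ℚ < a) → ℚ
cayley a a>0 = ((a - 1ℚ) ÷ (a + 1ℚ)) {{>-nonZero (1+pos a>0)}}

cayley-eq : ∀ a (a>0 : 0ℚ < a) → cayley a a>0 * (a + 1ℚ) ≡ a - 1ℚ
cayley-eq a a>0 = trans (*-assoc (a - 1ℚ) _ (a + 1ℚ))
  (trans (cong ((a - 1ℚ) *_) (*-inverseˡ (a + 1ℚ) {{>-nonZero (1+pos a>0)}}))
         (*-identityʳ (a - 1ℚ)))

cayley-≡ : ∀ a (a>0 : 0ℚ < a) →
  cayley a a>0 ≡ 1ℚ - 2ℚ * (1/ (a + 1ℚ)) {{>-nonZero (1+pos a>0)}}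
cayley-≡ a a>0 = trans
  (solve 2 (λ a i → (a :- con 1ℚ) :* i := (i :* (a :+ con 1ℚ)) :- con 2ℚ :* i) refl a i)
  (cong (_- 2ℚ * i) (*-inverseˡ (a + 1ℚ) {{>-nonZero (1+pos a>0)}}))
  where
  i : ℚ
  i = (1/ (a + 1ℚ)) {{>-nonZero (1+pos a>0)}}

1≤1+a : ∀ {a} → 0ℚ < a → 1ℚ ≤ a + 1ℚ
1≤1+a {a} a>0 = subst (_≤ a + 1ℚ) (+-identityˡ 1ℚ) (+-monoˡ-≤ 1ℚ {0ℚ} {a} (<⇒≤ a>0))

cayley-lipschitz : ∀ a b (a>0 : 0ℚ < a) (b>0 : 0ℚ < b) →
  ∣ cayley a a>0 - cayley b b>0 ∣ ≤ 2ℚ * ∣ a - b ∣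
cayley-lipschitz a b a>0 b>0 = begin
  ∣ cayley a a>0 - cayley b b>0 ∣
    ≡⟨ cong₂ (λ s t → ∣ s - t ∣) (cayley-≡ a a>0) (cayley-≡ b b>0) ⟩
  ∣ (1ℚ - 2ℚ * i) - (1ℚ - 2ℚ * j) ∣
    ≡⟨ cong ∣_∣ (solve 2 (λ i j → (con 1ℚ :- con 2ℚ :* i) :- (con 1ℚ :- con 2ℚ :* j)
         := con 2ℚ :* (j :- i)) refl i j) ⟩
  ∣ 2ℚ * (j - i) ∣
    ≡⟨ ∣p*q∣≡∣p∣*∣q∣ 2ℚ (j - i) ⟩
  2ℚ * ∣ j - i ∣
    ≡⟨ cong (2ℚ *_) (∣-∣-sym j i) ⟩
  2ℚ * ∣ i - j ∣
    ≤⟨ *-monoˡ {∣ i - j ∣} {∣ (a + 1ℚ) - (b + 1ℚ) ∣} 2ℚ 0≤2 (subst (∣ i - j ∣ ≤_)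
         (*-identityˡ ∣ (a + 1ℚ) - (b + 1ℚ) ∣)
         (inv-lipschitz {a + 1ℚ} {i} {b + 1ℚ} {j} {1ℚ} {1ℚ} 0<1 (1≤1+a a>0) (1≤1+a b>0)
           (*-inverseˡ (a + 1ℚ) {{>-nonZero (1+pos a>0)}})
           (*-inverseˡ (b + 1ℚ) {{>-nonZero (1+pos b>0)}}) refl)) ⟩
  2ℚ * ∣ (a + 1ℚ) - (b + 1ℚ) ∣
    ≡⟨ cong (λ t → 2ℚ * ∣ t ∣)
         (solve 2 (λ a b → (a :+ con 1ℚ) :- (b :+ con 1ℚ) := a :- b) refl a b) ⟩
  2ℚ * ∣ a - b ∣ ∎
  where
  i j : ℚ
  i = (1/ (a + 1ℚ)) {{>-nonZero (1+pos a>0)}}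
  j = (1/ (b + 1ℚ)) {{>-nonZero (1+pos b>0)}}

cayley-mono : ∀ a b (a>0 : 0ℚ < a) (b>0 : 0ℚ < b) → a ≤ b → cayley a a>0 ≤ cayley b b>0
cayley-mono a b a>0 b>0 a≤b = subst₂ _≤_ (sym (cayley-≡ a a>0)) (sym (cayley-≡ b b>0))
  (+-monoʳ-≤ 1ℚ { - (2ℚ * i)} { - (2ℚ * j)} (neg-antimono-≤ {2ℚ * j} {2ℚ * i}
    (*-monoˡ {j} {i} 2ℚ 0≤2 (inv-antitone {b + 1ℚ} {j} {a + 1ℚ} {i} (1+pos a>0)
      (+-monoˡ-≤ 1ℚ {a} {b} a≤b)
      (*-inverseˡ (b + 1ℚ) {{>-nonZero (1+pos b>0)}})
      (*-inverseˡ (a + 1ℚ) {{>-nonZero (1+pos a>0)}})))))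
  where
  i j : ℚ
  i = (1/ (a + 1ℚ)) {{>-nonZero (1+pos a>0)}}
  j = (1/ (b + 1ℚ)) {{>-nonZero (1+pos b>0)}}

cayley-bound : ∀ {δ k B} a (a>0 : 0ℚ < a) → 0ℚ ≤ δ → δ ≤ 1ℚ → δ ≤ a → a ≤ B →
  0ℚ ≤ k → k * (B + 1ℚ) ≡ 1ℚ → ∣ cayley a a>0 ∣ ≤ 1ℚ - δ * k
cayley-bound {δ} {k} {B} a a>0 δ≥0 δ≤1 δ≤a a≤B k≥0 k-eq = ∣∣-≤ {z} {1ℚ - c}
  (*-cancel {z} {1ℚ - c} s (1+pos a>0) (subst (_≤ (1ℚ - c) * s) (sym (cayley-eq a a>0))
    (nonneg-sub {a - 1ℚ} {(1ℚ - c) * s} (subst (0ℚ ≤_)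
      (solve 2 (λ a c → con 2ℚ :- c :* (a :+ con 1ℚ)
         := (con 1ℚ :- c) :* (a :+ con 1ℚ) :- (a :- con 1ℚ)) refl a c)
      (sub-nonneg {c * s} {2ℚ} (≤-trans cs≤δ (≤-trans δ≤1 1≤2)))))))
  (*-cancel { - z} {1ℚ - c} s (1+pos a>0) (subst (_≤ (1ℚ - c) * s)
    (trans (cong -_ (sym (cayley-eq a a>0))) (neg-distribˡ-* z s))
    (nonneg-sub { - (a - 1ℚ)} {(1ℚ - c) * s} (subst (0ℚ ≤_)
      (solve 2 (λ a c → (a :+ a) :- c :* (a :+ con 1ℚ)
         := (con 1ℚ :- c) :* (a :+ con 1ℚ) :- (:- (a :- con 1ℚ))) refl a c)
      (sub-nonneg {c * s} {a + a} (≤-trans cs≤δ (≤-trans δ≤a (p≤p+q a a (<⇒≤ a>0)))))))))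
  where
  z s c : ℚ
  z = cayley a a>0
  s = a + 1ℚ
  c = δ * k
  1≤2 : 1ℚ ≤ 2ℚ
  1≤2 = toWitness {a? = 1ℚ ≤? 2ℚ} _
  cs≤δ : c * s ≤ δ
  cs≤δ = begin
    c * s               ≤⟨ *-monoˡ {s} {B + 1ℚ} c (*-nonneg {δ} {k} δ≥0 k≥0)
                             (+-monoˡ-≤ 1ℚ {a} {B} a≤B) ⟩
    c * (B + 1ℚ)        ≡⟨ *-assoc δ k (B + 1ℚ) ⟩
    δ * (k * (B + 1ℚ))  ≡⟨ trans (cong (δ *_) k-eq) (*-identityʳ δ) ⟩
    δ                   ∎

⊓-pos : ∀ {p q} → 0ℚ < p → 0ℚ < q → 0ℚ < p ⊓ q
⊓-pos {p} {q} p>0 q>0 = by-cases (≤-total p q)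
  where
  by-cases : p ≤ q ⊎ q ≤ p → 0ℚ < p ⊓ q
  by-cases (inj₁ h) = subst (0ℚ <_) (sym (p≤q⇒p⊓q≡p h)) p>0
  by-cases (inj₂ h) = subst (0ℚ <_) (sym (p≥q⇒p⊓q≡q h)) q>0

module Log (x : ℝ) (x>0 : 0ℝ <ℝ x) where
  open Tail x x>0

  z : ℕ → ℚ
  z n = cayley (tail n) (tail>0 n)

  log-seq : ℕ → ℚ
  log-seq n = 2ℚ * artanh-sum n (z n)

  z-cauchy : Cauchy z
  z-cauchy = Cauchy-lipschitz {tail} {z} 2ℚ 0<2 tail-cauchy
    λ m n → cayley-lipschitz (tail m) (tail n) (tail>0 m) (tail>0 n)

  bounded : ∃[ B ] (0ℚ < B × ∃[ N ] ∀ n → N ℕ.≤ n → ∣ tail n ∣ ≤ B)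
  bounded = Cauchy-bounded {tail} tail-cauchy

  B δ k c r K : ℚ
  B = proj₁ bounded
  B>0 : 0ℚ < B
  B>0 = proj₁ (proj₂ bounded)
  N : ℕ
  N = proj₁ (proj₂ (proj₂ bounded))
  δ = bound ⊓ 1ℚ
  δ>0 : 0ℚ < δ
  δ>0 = ⊓-pos {bound} {1ℚ} bound>0 0<1
  k-data : ∃[ k ] (0ℚ < k × k * (B + 1ℚ) ≡ 1ℚ)
  k-data = reciprocal (B + 1ℚ) (1+pos B>0)
  k = proj₁ k-data
  k>0 : 0ℚ < k
  k>0 = proj₁ (proj₂ k-data)
  c = δ * k
  c>0 : 0ℚ < c
  c>0 = *-pos {δ} {k} δ>0 k>0
  c≤1 : c ≤ 1ℚ
  c≤1 = *-mono {δ} {1ℚ} {k} {1ℚ} (<⇒≤ k>0) 0≤1 (p⊓q≤q bound 1ℚ)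
    (inv-antitone {B + 1ℚ} {k} {1ℚ} {1ℚ} 0<1 (1≤1+a B>0) (proj₂ (proj₂ k-data)) refl)
  r = 1ℚ - c
  1-r≡c : 1ℚ - r ≡ c
  1-r≡c = solve 1 (λ c → con 1ℚ :- (con 1ℚ :- c) := c) refl c
  r≥0 : 0ℚ ≤ r
  r≥0 = sub-nonneg {c} {1ℚ} c≤1
  r<1 : r < 1ℚ
  r<1 = subst (r <_) (+-identityʳ 1ℚ)
    (+-monoʳ-< 1ℚ { - c} {0ℚ} (neg-antimono-< {0ℚ} {c} c>0))
  K-data : ∃[ K ] (0ℚ < K × K * c ≡ 1ℚ)
  K-data = reciprocal c c>0
  K = proj₁ K-data
  K>0 : 0ℚ < K
  K>0 = proj₁ (proj₂ K-data)

  z-bound : ∀ n → N ℕ.≤ n → ∣ z n ∣ ≤ r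
  z-bound n N≤n = cayley-bound {δ} {k} {B} (tail n) (tail>0 n) (<⇒≤ δ>0) (p⊓q≤q bound 1ℚ)
    (≤-trans (p⊓q≤p bound 1ℚ) (tail-bound n))
    (≤-trans (p≤∣p∣ (tail n)) (proj₂ (proj₂ (proj₂ bounded)) n N≤n))
    (<⇒≤ k>0) (proj₂ (proj₂ k-data))

  sum-cauchy : Cauchy (λ n → artanh-sum n (z n))
  sum-cauchy = Cauchy-dominated {z} {r ^_} {λ n → artanh-sum n (z n)} K N K>0
    z-cauchy (Cauchy-^ {r} r≥0 r<1)
    λ m n N≤m N≤n → ArtanhBounds.difference {r} {K} r≥0 (<⇒≤ r<1) (<⇒≤ K>0)
      (trans (cong (K *_) 1-r≡c) (proj₂ (proj₂ K-data))) m n (z m) (z n)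
      (z-bound m N≤m) (z-bound n N≤n)

  log-cauchy : Cauchy log-seq
  log-cauchy = Cauchy-* {λ _ → 2ℚ} {λ n → artanh-sum n (z n)} (Cauchy-const 2ℚ) sum-cauchy

log : (x : ℝ) → 0ℝ <ℝ x → ℝ
log x x>0 = real log-seq log-cauchy
  where open Log x x>0

artanh-term-nonneg : ∀ k {z} → 0ℚ ≤ z → 0ℚ ≤ artanh-term k z
artanh-term-nonneg k {z} z≥0 = *-nonneg {z ^ suc (2 ℕ.* k)} {odd-recip k}
  (^-nonneg (suc (2 ℕ.* k)) z≥0) (odd-recip-nonneg k)

artanh-sum-mono : ∀ n {w z} → 0ℚ ≤ w → w ≤ z → artanh-sum n w ≤ artanh-sum n z
artanh-sum-mono zero w≥0 w≤z = ≤-refl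
artanh-sum-mono (suc n) {w} {z} w≥0 w≤z = +-mono-≤
  {artanh-sum n w} {artanh-sum n z} {artanh-term n w} {artanh-term n z}
  (artanh-sum-mono n w≥0 w≤z)
  (*-monoʳ {w ^ suc (2 ℕ.* n)} {z ^ suc (2 ℕ.* n)} (odd-recip n) (odd-recip-nonneg n)
    (^-mono (suc (2 ℕ.* n)) w≥0 w≤z))

artanh-sum-grows : ∀ d n {z} → 0ℚ ≤ z → artanh-sum n z ≤ artanh-sum (d ℕ.+ n) z
artanh-sum-grows zero n z≥0 = ≤-refl
artanh-sum-grows (suc d) n {z} z≥0 = ≤-trans (artanh-sum-grows d n z≥0)
  (p≤p+q (artanh-sum (d ℕ.+ n) z) (artanh-term (d ℕ.+ n) z) (artanh-term-nonneg (d ℕ.+ n) z≥0))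

artanh-sum-lower : ∀ {m n w z} → m ℕ.≤ n → 0ℚ ≤ w → w ≤ z → artanh-sum m w ≤ artanh-sum n z
artanh-sum-lower {m} {n} {w} {z} m≤n w≥0 w≤z = ≤-trans (artanh-sum-mono m w≥0 w≤z)
  (subst (λ i → artanh-sum m z ≤ artanh-sum i z) (ℕₚ.m∸n+n≡m m≤n)
    (artanh-sum-grows (n ℕ.∸ m) m (≤-trans w≥0 w≤z)))

1<⇒0< : ∀ {x} → 1ℝ <ℝ x → 0ℝ <ℝ x
1<⇒0< {x} (ε , ε>0 , N , h) = ε , ε>0 , N , λ n N≤n →
  ≤-trans (+-monoˡ-≤ ε {0ℚ} {1ℚ} 0≤1) (h n N≤n)

log-pos : ∀ {x} (x>0 : 0ℝ <ℝ x) → 1ℝ <ℝ x → 0ℝ <ℝ log x x>0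
log-pos {x} x>0 (ε , ε>0 , M , h) =
  2ℚ * artanh-sum 1 w , *-pos {2ℚ} {artanh-sum 1 w} 0<2 (subst (0ℚ <_) (sym sum-1) w>0) ,
  M ℕ.+ 1 , λ n le → subst (_≤ log-seq n) (sym (+-identityˡ (2ℚ * artanh-sum 1 w)))
    (*-monoˡ {artanh-sum 1 w} {artanh-sum n (z n)} 2ℚ 0≤2
      (artanh-sum-lower {1} {n} {w} {z n} (ℕₚ.≤-trans (ℕₚ.m≤n+m 1 M) le) (<⇒≤ w>0)
        (cayley-mono (1ℚ + ε) (tail n) 1+ε>0 (tail>0 n)
          (h (cutoff ℕ.+ n) (ℕₚ.≤-trans (ℕₚ.≤-trans (ℕₚ.m≤m+n M 1) le) (ℕₚ.m≤n+m n cutoff))))))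
  where
  open Tail x x>0
  open Log x x>0 using (z; log-seq)
  1+ε>0 : 0ℚ < 1ℚ + ε
  1+ε>0 = +-pos {1ℚ} {ε} 0<1 ε>0
  w i : ℚ
  w = cayley (1ℚ + ε) 1+ε>0
  i = (1/ ((1ℚ + ε) + 1ℚ)) {{>-nonZero (1+pos 1+ε>0)}}
  i>0 : 0ℚ < i
  i>0 = positive⁻¹ i {{1/pos⇒pos ((1ℚ + ε) + 1ℚ) {{positive (1+pos 1+ε>0)}}}}
  w>0 : 0ℚ < w
  w>0 = *-pos {(1ℚ + ε) - 1ℚ} {i}
    (subst (0ℚ <_) (solve 1 (λ e → e := (con 1ℚ :+ e) :- con 1ℚ) refl ε) ε>0) i>0
  sum-1 : artanh-sum 1 w ≡ w
  sum-1 = solve 1 (λ w → con 0ℚ :+ (w :* con 1ℚ) :* con 1ℚ := w) refl w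

1<log : ∀ {x} (x>0 : 0ℝ <ℝ x) → (∀ n → fromℕ 3 ≤ seq x n) → 1ℝ <ℝ log x x>0
1<log {x} x>0 h = + 1 / 12 , /-positive 1 12 , 2 , λ n 2≤n →
  *-monoˡ {artanh-sum 2 ½} {artanh-sum n (z n)} 2ℚ 0≤2
    (artanh-sum-lower {2} {n} {½} {z n} 2≤n (toWitness {a? = 0ℚ ≤? ½} _)
      (cayley-mono (fromℕ 3) (tail n) (/-positive 3 1) (tail>0 n) (h (cutoff ℕ.+ n))))
  where
  open Tail x x>0
  open Log x x>0 using (z)

*ℝ-pos : ∀ {x y} → 0ℝ <ℝ x → 0ℝ <ℝ y → 0ℝ <ℝ x *ℝ y
*ℝ-pos {x} {y} (ε , ε>0 , M , h) (η , η>0 , N , g) =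
  ε * η , *-pos {ε} {η} ε>0 η>0 , M ℕ.+ N , λ n le →
  let ε≤ = subst (_≤ seq x n) (+-identityˡ ε) (h n (ℕₚ.≤-trans (ℕₚ.m≤m+n M N) le))
      η≤ = subst (_≤ seq y n) (+-identityˡ η) (g n (ℕₚ.≤-trans (ℕₚ.m≤n+m N M) le))
  in subst (_≤ seq x n * seq y n) (sym (+-identityˡ (ε * η)))
    (*-mono {ε} {seq x n} {η} {seq y n} (<⇒≤ η>0) (≤-trans (<⇒≤ ε>0) ε≤) ε≤ η≤)

⌜⌝-pos : ∀ {q} → 0ℚ < q → 0ℝ <ℝ ⌜ q ⌝
⌜⌝-pos {q} q>0 = q , q>0 , 0 , λ _ _ → ≤-reflexive (+-identityˡ q)

1<⌜fromℕ⌝ : ∀ {n} → 2 ℕ.≤ n → 1ℝ <ℝ ⌜ fromℕ n ⌝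
1<⌜fromℕ⌝ {n} 2≤n = 1ℚ , 0<1 , 0 , λ _ _ → fromℕ-mono {2} {n} 2≤n

σ : ℕ → ℕ
σ n = sum (filter (_∣? n) (applyUpTo suc n))

abundancy : (n : ℕ) .{{_ : ℕ.NonZero n}} → ℚ
abundancy n = + σ n / n

σ>0 : ∀ n .{{_ : ℕ.NonZero n}} → 0 ℕ.< σ n
σ>0 (suc n) = subst (λ xs → 0 ℕ.< sum xs)
  (sym (filter-accept (_∣? suc n) {1} {applyUpTo (λ i → suc (suc i)) n} (1∣ suc n))) (s≤s z≤n)

abundancy-pos : ∀ n .{{_ : ℕ.NonZero n}} → 0ℚ < abundancy n
abundancy-pos n = /-positive (σ n) n {{ℕ.>-nonZero (σ>0 n)}}

logℚ : (q : ℚ) → 0ℚ < q → ℝ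
logℚ q q>0 = log ⌜ q ⌝ (⌜⌝-pos {q} q>0)

logℕ : (n : ℕ) .{{_ : ℕ.NonZero n}} → ℝ
logℕ n = logℚ (fromℕ n) (/-positive n 1)

-- The defining inequality, for m < n.  The hypothesis 3 ≤ m makes log m > 1,
-- so that log (log m) is defined and positive; it holds for every m ≥ 10080.

module Inequality {m n : ℕ} (3≤m : 3 ℕ.≤ m) (m<n : m ℕ.< n) where

  instance
    m≢0 : ℕ.NonZero m
    m≢0 = ℕ.>-nonZero (ℕₚ.≤-trans (s≤s z≤n) 3≤m)
    n≢0 : ℕ.NonZero n
    n≢0 = ℕ.>-nonZero (ℕₚ.≤-trans (s≤s z≤n) m<n)
    abundancy-m≢0 : NonZero (abundancy m)
    abundancy-m≢0 = >-nonZero (abundancy-pos m)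

  1<logm : 1ℝ <ℝ logℕ m
  1<logm = 1<log {⌜ fromℕ m ⌝} (⌜⌝-pos {fromℕ m} (/-positive m 1)) (λ _ → fromℕ-mono {3} {m} 3≤m)

  logm>0 : 0ℝ <ℝ logℕ m
  logm>0 = 1<⇒0< {logℕ m} 1<logm

  loglogm : ℝ
  loglogm = log (logℕ m) logm>0

  logn>0 : 0ℝ <ℝ logℕ n
  logn>0 = log-pos {⌜ fromℕ n ⌝} (⌜⌝-pos {fromℕ n} (/-positive n 1))
    (1<⌜fromℕ⌝ {n} (ℕₚ.≤-trans (s≤s (ℕₚ.≤-trans (s≤s z≤n) 3≤m)) m<n))

  loglogm>0 : 0ℝ <ℝ loglogm
  loglogm>0 = log-pos {logℕ m} logm>0 1<logm

  denominator-pos : 0ℝ <ℝ logℕ n *ℝ loglogm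
  denominator-pos = *ℝ-pos {logℕ n} {loglogm} logn>0 loglogm>0

  Holds : Set
  Holds = 1ℝ +ℝ (logℚ (+ n / m) (/-positive n m) /ℝ (logℕ n *ℝ loglogm) [ denominator-pos ])
          <ℝ ⌜ abundancy n ÷ abundancy m ⌝

open Inequality using () renaming (Holds to Exceeds)

IsNext : {m : ℕ} → 3 ℕ.≤ m → ℕ → Set
IsNext {m} 3≤m n =
  Σ[ m<n ∈ m ℕ.< n ]
    (Exceeds 3≤m m<n × (∀ j (m<j : m ℕ.< j) → j ℕ.< n → ¬ Exceeds 3≤m m<j))

-- Term k n states that the construction reaches its k-th term, counted from 0,
-- and that this term is n.
Term : ℕ → ℕ → Set
Term zero    n = n ≡ 10080
Term (suc k) n = Σ[ m ∈ ℕ ] Σ[ 3≤m ∈ 3 ℕ.≤ m ] (Term k m × IsNext 3≤m n)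

X′ : Pred ℕ 0ℓ
X′ n = ∃[ k ] Term k n

-- The ratio σ(n)/n is unbounded: for n = (2^k)!, the divisors n/j with
-- 2^i ≤ j < 2^(i+1) sum to at least n/2 for each i < k.  On the other hand,
-- since log (n/m) ≤ log n, the right-hand side of the defining inequality is
-- at most 1 + 1 / log log m whatever n is.  Hence some n > m satisfies it, and
-- the least such n is the next term, so the construction never stops.

module Submission where

open import Defs
open import Data.Nat.InfinitelyOften using (Inf)

open import Data.Nat.Base as ℕ using (ℕ; zero; suc; s≤s; z≤n; NonZero; _!)
import Data.Nat.Properties as ℕₚ
open import Data.Nat.Divisibility using (_∣_; _∣?_; divides; ∣-trans; m∣m*n; ∣⇒≤; m≤n⇒m!∣n!)
import Data.Nat.DivMod as ℕᵈ
open import Data.Nat.Induction using (<-rec)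
open import Data.Nat.ListAction using (sum)
open import Data.Nat.ListAction.Properties using (sum-++)
open import Data.List.Base using ([]; _++_; [_]; filter; applyUpTo)
open import Data.List.Properties using (applyUpTo-∷ʳ; filter-++; filter-accept)
open import Data.Integer.Base as ℤ using (+_)
import Data.Integer.Properties as ℤₚ
open import Data.Rational.Base hiding (NonZero; truncate)
open import Data.Rational.Properties
import Data.Rational.Unnormalised.Base as ℚᵘ
import Data.Rational.Unnormalised.Properties as ℚᵘₚ
open import Data.Rational.Solver using (module +-*-Solver)
open import Data.Product.Base using (Σ-syntax; ∃-syntax; _×_; _,_; proj₁; proj₂)
open import Data.Sum.Base using (inj₁; inj₂)
open import Relation.Nullary using (¬_)
open import Relation.Nullary.Decidable using (toWitness)
open import Relation.Binary.PropositionalEquality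
  using (_≡_; refl; sym; trans; cong; cong₂; subst; subst₂; module ≡-Reasoning)

open Inequality using () renaming (Holds to Exceeds)
open +-*-Solver using (solve; _:=_; _:+_; _:*_; con)

-- Lower bounds for truncated divisor sums

divisorSum : ℕ → ℕ → ℕ
divisorSum n b = sum (filter (_∣? n) (applyUpTo suc b))

divisorSum-suc : ∀ n b →
  divisorSum n (suc b) ≡ divisorSum n b ℕ.+ sum (filter (_∣? n) [ suc b ])
divisorSum-suc n b = begin
  sum (filter (_∣? n) (applyUpTo suc (suc b)))
    ≡⟨ cong (λ xs → sum (filter (_∣? n) xs)) (sym (applyUpTo-∷ʳ suc b)) ⟩
  sum (filter (_∣? n) (applyUpTo suc b ++ [ suc b ]))
    ≡⟨ cong sum (filter-++ (_∣? n) (applyUpTo suc b) [ suc b ]) ⟩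
  sum (filter (_∣? n) (applyUpTo suc b) ++ filter (_∣? n) [ suc b ])
    ≡⟨ sum-++ (filter (_∣? n) (applyUpTo suc b)) _ ⟩
  divisorSum n b ℕ.+ sum (filter (_∣? n) [ suc b ]) ∎
  where open ≡-Reasoning

divisorSum-mono : ∀ n {a b} → a ℕ.≤ b → divisorSum n a ℕ.≤ divisorSum n b
divisorSum-mono n {a} {zero} z≤n = ℕₚ.≤-refl
divisorSum-mono n {a} {suc b} a≤1+b with ℕₚ.m≤n⇒m<n∨m≡n a≤1+b
... | inj₂ refl = ℕₚ.≤-refl
... | inj₁ (s≤s a≤b) = ℕₚ.≤-trans (divisorSum-mono n a≤b)
  (ℕₚ.≤-trans (ℕₚ.m≤m+n _ _) (ℕₚ.≤-reflexive (sym (divisorSum-suc n b))))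

divisorSum-divisor : ∀ n {c d} → d ∣ n → c ℕ.< d → d ℕ.+ divisorSum n c ℕ.≤ divisorSum n d
divisorSum-divisor n {c} {suc b} d∣n (s≤s c≤b) = begin
  suc b ℕ.+ divisorSum n c                            ≤⟨ ℕₚ.+-monoʳ-≤ (suc b) (divisorSum-mono n c≤b) ⟩
  suc b ℕ.+ divisorSum n b                            ≡⟨ ℕₚ.+-comm (suc b) _ ⟩
  divisorSum n b ℕ.+ suc b                            ≡⟨ cong (divisorSum n b ℕ.+_) (sym (ℕₚ.+-identityʳ (suc b))) ⟩
  divisorSum n b ℕ.+ sum [ suc b ]
    ≡⟨ cong (λ xs → divisorSum n b ℕ.+ sum xs) (sym (filter-accept (_∣? n) {suc b} {[]} d∣n)) ⟩
  divisorSum n b ℕ.+ sum (filter (_∣? n) [ suc b ])   ≡⟨ sym (divisorSum-suc n b) ⟩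
  divisorSum n (suc b)                                ∎
  where open ℕₚ.≤-Reasoning

DivisibleUpTo : ℕ → ℕ → Set
DivisibleUpTo b n = ∀ {j} → 0 ℕ.< j → j ℕ.≤ b → j ∣ n

-- For `i ≤ t < l + i` the quotients `n / t` are `l` distinct divisors of `n`, all above
-- `n / (l + i)` and at most `n / i`, and each at least `c`. The induction adds the smallest of them
-- first; `c` is left free so that it can stay fixed while the cutoff `n / (l + i)` grows.
divisorSum-block : ∀ n l i {c} .{{_ : NonZero n}} .{{_ : NonZero i}} .{{_ : NonZero (l ℕ.+ i)}} →
  DivisibleUpTo (l ℕ.+ i) n → c ℕ.≤ n ℕᵈ./ (l ℕ.+ i) →
  l ℕ.* c ℕ.+ divisorSum n (n ℕᵈ./ (l ℕ.+ i)) ℕ.≤ divisorSum n (n ℕᵈ./ i)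
divisorSum-block n zero i h c≤ = ℕₚ.≤-refl
divisorSum-block n (suc l) i {c} h c≤ = begin
  (c ℕ.+ l ℕ.* c) ℕ.+ S (n ℕᵈ./ suc t)   ≡⟨ cong (ℕ._+ S (n ℕᵈ./ suc t)) (ℕₚ.+-comm c (l ℕ.* c)) ⟩
  (l ℕ.* c ℕ.+ c) ℕ.+ S (n ℕᵈ./ suc t)   ≡⟨ ℕₚ.+-assoc (l ℕ.* c) c _ ⟩
  l ℕ.* c ℕ.+ (c ℕ.+ S (n ℕᵈ./ suc t))   ≤⟨ ℕₚ.+-monoʳ-≤ (l ℕ.* c) (ℕₚ.+-monoˡ-≤ (S (n ℕᵈ./ suc t)) c≤d) ⟩
  l ℕ.* c ℕ.+ (d ℕ.+ S (n ℕᵈ./ suc t))   ≤⟨ ℕₚ.+-monoʳ-≤ (l ℕ.* c) (divisorSum-divisor n d∣n d′<d) ⟩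
  l ℕ.* c ℕ.+ S d                        ≤⟨ divisorSum-block n l i (λ j>0 j≤t → h j>0 (ℕₚ.m≤n⇒m≤1+n j≤t)) c≤d ⟩
  S (n ℕᵈ./ i)                           ∎
  where
  open ℕₚ.≤-Reasoning
  S : ℕ → ℕ
  S = divisorSum n
  t : ℕ
  t = l ℕ.+ i
  instance
    t≢0 : NonZero t
    t≢0 = ℕ.>-nonZero (ℕₚ.≤-trans (ℕ.>-nonZero⁻¹ i) (ℕₚ.m≤n+m i l))
  d : ℕ
  d = n ℕᵈ./ t
  d*t≡n : d ℕ.* t ≡ n
  d*t≡n = ℕᵈ.m/n*n≡m (h (ℕ.>-nonZero⁻¹ t) (ℕₚ.n≤1+n t))
  d∣n : d ∣ n
  d∣n = divides t (trans (sym d*t≡n) (ℕₚ.*-comm d t))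
  c≤d : c ℕ.≤ d
  c≤d = ℕₚ.≤-trans c≤ (ℕᵈ./-monoʳ-≤ n (ℕₚ.n≤1+n t))
  d≢0 : NonZero d
  d≢0 = ℕₚ.m*n≢0⇒m≢0 d {t} {{subst NonZero (sym d*t≡n) (ℕ.≢-nonZero (ℕ.≢-nonZero⁻¹ n))}}
  d′<d : n ℕᵈ./ suc t ℕ.< d
  -- Here `n = d * t < d * suc t`, because `d` is positive.
  d′<d = ℕᵈ.m<n*o⇒m/o<n (subst₂ ℕ._<_ d*t≡n (sym (ℕₚ.*-suc d t))
    (ℕₚ.m<n+m (d ℕ.* t) (ℕ.>-nonZero⁻¹ d {{d≢0}})))

-- A block of `i` divisors, each at least `n / (i + i)`, contributes at least half of `n`.
-- Everything is doubled to stay within the natural numbers.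
divisorSum-double : ∀ n i .{{_ : NonZero n}} .{{_ : NonZero i}} .{{_ : NonZero (i ℕ.+ i)}} →
  DivisibleUpTo (i ℕ.+ i) n →
  n ℕ.+ 2 ℕ.* divisorSum n (n ℕᵈ./ (i ℕ.+ i)) ℕ.≤ 2 ℕ.* divisorSum n (n ℕᵈ./ i)
divisorSum-double n i h = begin
  n ℕ.+ 2 ℕ.* s                    ≡⟨ cong (ℕ._+ 2 ℕ.* s) (sym n≡2ic) ⟩
  2 ℕ.* (i ℕ.* c) ℕ.+ 2 ℕ.* s      ≡⟨ sym (ℕₚ.*-distribˡ-+ 2 (i ℕ.* c) s) ⟩
  2 ℕ.* (i ℕ.* c ℕ.+ s)            ≤⟨ ℕₚ.*-monoʳ-≤ 2 (divisorSum-block n i i h ℕₚ.≤-refl) ⟩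
  2 ℕ.* divisorSum n (n ℕᵈ./ i)    ∎
  where
  open ℕₚ.≤-Reasoning
  c s : ℕ
  c = n ℕᵈ./ (i ℕ.+ i)
  s = divisorSum n c
  n≡2ic : 2 ℕ.* (i ℕ.* c) ≡ n
  n≡2ic = begin-equality
    2 ℕ.* (i ℕ.* c)           ≡⟨ cong (i ℕ.* c ℕ.+_) (ℕₚ.+-identityʳ (i ℕ.* c)) ⟩
    i ℕ.* c ℕ.+ i ℕ.* c       ≡⟨ sym (ℕₚ.*-distribʳ-+ c i i) ⟩
    (i ℕ.+ i) ℕ.* c           ≡⟨ ℕᵈ.m*[n/m]≡n (h (ℕ.>-nonZero⁻¹ (i ℕ.+ i)) ℕₚ.≤-refl) ⟩
    n                         ∎

-- The blocks between `n / 2 ^ suc i` and `n / 2 ^ i` for `i < k` are stacked, each contributing `n`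
-- to the doubled sum.
divisorSum-dyadic : ∀ n k .{{_ : NonZero n}} → DivisibleUpTo (2 ℕ.^ k) n →
  k ℕ.* n ℕ.+ 2 ℕ.* divisorSum n ((n ℕᵈ./ 2 ℕ.^ k) {{ℕₚ.m^n≢0 2 k}}) ℕ.≤ 2 ℕ.* σ n
divisorSum-dyadic n zero h =
  -- Once `n / 1` is replaced by `n`, the truncation at `n` is `σ n` by definition.
  ℕₚ.≤-reflexive (cong (λ b → 2 ℕ.* divisorSum n b) (ℕᵈ.n/1≡n n))
divisorSum-dyadic n (suc k) h = begin
  (n ℕ.+ k ℕ.* n) ℕ.+ 2 ℕ.* S (n ℕᵈ./ 2 ℕ.^ suc k)
    ≡⟨ cong₂ (λ a b → a ℕ.+ 2 ℕ.* S b) (ℕₚ.+-comm n (k ℕ.* n)) (ℕᵈ./-congʳ 2i≡i+i) ⟩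
  (k ℕ.* n ℕ.+ n) ℕ.+ 2 ℕ.* S (n ℕᵈ./ (i ℕ.+ i))
    ≡⟨ ℕₚ.+-assoc (k ℕ.* n) n _ ⟩
  k ℕ.* n ℕ.+ (n ℕ.+ 2 ℕ.* S (n ℕᵈ./ (i ℕ.+ i)))
    ≤⟨ ℕₚ.+-monoʳ-≤ (k ℕ.* n) (divisorSum-double n i (subst (λ b → DivisibleUpTo b n) 2i≡i+i h)) ⟩
  k ℕ.* n ℕ.+ 2 ℕ.* S (n ℕᵈ./ i)
    ≤⟨ divisorSum-dyadic n k (λ j>0 j≤i → h j>0 (ℕₚ.≤-trans j≤i (ℕₚ.m≤m+n i _))) ⟩
  2 ℕ.* σ n ∎
  where
  open ℕₚ.≤-Reasoning
  S : ℕ → ℕ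
  S = divisorSum n
  i : ℕ
  i = 2 ℕ.^ k
  2i≡i+i : 2 ℕ.* i ≡ i ℕ.+ i
  2i≡i+i = cong (i ℕ.+_) (ℕₚ.+-identityʳ i)
  instance
    i≢0 : NonZero i
    i≢0 = ℕₚ.m^n≢0 2 k
    2i≢0 : NonZero (2 ℕ.^ suc k)
    2i≢0 = ℕₚ.m^n≢0 2 (suc k)
    i+i≢0 : NonZero (i ℕ.+ i)
    i+i≢0 = subst NonZero 2i≡i+i 2i≢0

!-divisibleUpTo : ∀ b → DivisibleUpTo b (b !)
!-divisibleUpTo b {suc j} _ j<b = ∣-trans (m∣m*n (j !)) (m≤n⇒m!∣n! j<b)

k<2^k : ∀ k → k ℕ.< 2 ℕ.^ k
k<2^k zero    = s≤s z≤n
k<2^k (suc k) = ℕₚ.+-mono-≤ (ℕₚ.m^n>0 2 k) (ℕₚ.≤-trans (k<2^k k) (ℕₚ.≤-reflexive (sym (ℕₚ.+-identityʳ _))))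

-- The bound `k < n` is recorded so that one choice of `k` makes the ratio large and also places `n`
-- above a prescribed number.
σ-unbounded : ∀ k → ∃[ n ] (k ℕ.< n × k ℕ.* n ℕ.≤ 2 ℕ.* σ n)
σ-unbounded k = n , ℕₚ.<-≤-trans (k<2^k k) b≤n ,
  ℕₚ.≤-trans (ℕₚ.m≤m+n (k ℕ.* n) _) (divisorSum-dyadic n k (!-divisibleUpTo b))
  where
  b n : ℕ
  b = 2 ℕ.^ k
  n = b !
  instance
    n≢0 : NonZero n
    n≢0 = ℕₚ._!≢0 b
  b≤n : b ℕ.≤ n
  b≤n = ∣⇒≤ (!-divisibleUpTo b (ℕₚ.m^n>0 2 k) ℕₚ.≤-refl)

-- Bounds for the abundancy and for quotients of logarithms

abundancy-≥ : ∀ n k .{{_ : NonZero n}} → k ℕ.* n ℕ.≤ 2 ℕ.* σ n → fromℕ k ≤ 2ℚ * abundancy n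
abundancy-≥ n@(suc n-1) k h = toℚᵘ-cancel-≤
  (ℚᵘₚ.≤-respˡ-≃ (ℚᵘₚ.≃-sym (toℚᵘ-fromℕ k))
  (ℚᵘₚ.≤-respʳ-≃ (ℚᵘₚ.≃-sym (ℚᵘₚ.≃-trans (toℚᵘ-homo-* 2ℚ (abundancy n))
                    (ℚᵘₚ.*-congˡ {toℚᵘ 2ℚ} (toℚᵘ-fromℚᵘ (ℚᵘ.mkℚᵘ (+ σ n) n-1)))))
  (ℚᵘ.*≤* (subst₂ ℤ._≤_ (trans (ℤₚ.pos-* k n) (cong (λ d → + k ℤ.* + d) (sym (ℕₚ.*-identityˡ n))))
                          (trans (ℤₚ.pos-* 2 (σ n)) (sym (ℤₚ.*-identityʳ _)))
                          (ℤ.+≤+ h)))))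

/-≥1 : ∀ {n m} .{{_ : NonZero m}} → m ℕ.≤ n → 1ℚ ≤ + n / m
/-≥1 {n} {suc m} m≤n = toℚᵘ-cancel-≤
  (ℚᵘₚ.≤-respʳ-≃ (ℚᵘₚ.≃-sym (toℚᵘ-fromℚᵘ (ℚᵘ.mkℚᵘ (+ n) m)))
  (ℚᵘ.*≤* (subst₂ ℤ._≤_ (sym (ℤₚ.*-identityˡ _)) (sym (ℤₚ.*-identityʳ _)) (ℤ.+≤+ m≤n))))

/-≤-fromℕ : ∀ n m .{{_ : NonZero m}} → + n / m ≤ fromℕ n
/-≤-fromℕ n (suc m) = toℚᵘ-cancel-≤
  (ℚᵘₚ.≤-respˡ-≃ (ℚᵘₚ.≃-sym (toℚᵘ-fromℚᵘ (ℚᵘ.mkℚᵘ (+ n) m)))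
  (ℚᵘₚ.≤-respʳ-≃ (ℚᵘₚ.≃-sym (toℚᵘ-fromℕ n))
  (ℚᵘ.*≤* (ℤₚ.*-monoˡ-≤-nonNeg (+ n) (ℤ.+≤+ (s≤s z≤n))))))

-- For arguments at least 1 the artanh series has nonnegative terms, so its partial sums grow both
-- with the argument and with the number of terms. Two different indices are allowed because a
-- reciprocal reads its sequence at a shifted index.
logℚ-mono : ∀ {p q} (p>0 : 0ℚ < p) (q>0 : 0ℚ < q) → 1ℚ ≤ p → p ≤ q →
  ∀ {i j} → i ℕ.≤ j → seq (logℚ p p>0) i ≤ seq (logℚ q q>0) j
logℚ-mono {p} {q} p>0 q>0 1≤p p≤q {i} {j} i≤j =
  *-monoˡ {artanh-sum i (cayley p p>0)} {artanh-sum j (cayley q q>0)} 2ℚ 0≤2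
    -- `cayley 1ℚ` evaluates to 0, so monotonicity from 1 gives nonnegativity.
    (artanh-sum-lower i≤j (cayley-mono 1ℚ p 0<1 p>0 1≤p) (cayley-mono p q p>0 q>0 p≤q))

-- With `η = proj₁ y>0`, the terms of `y` are eventually at least `η`, so a/(xy) is at most 1/y and
-- hence at most 1/η, which is `c`. The reciprocal skips the first `M + N` terms, the cutoff built
-- by `*ℝ-pos`; thus term `i` of `a` meets term `M + N + i` of `x` and `y`, and the bound holds at
-- every index.
quotient-bound : ∀ {a x y c} (x>0 : 0ℝ <ℝ x) (y>0 : 0ℝ <ℝ y) → 0ℚ ≤ c → c * proj₁ y>0 ≡ 1ℚ →
  (∀ {i j} → i ℕ.≤ j → seq a i ≤ seq x j) →
  ∀ i → seq (a /ℝ (x *ℝ y) [ *ℝ-pos {x} {y} x>0 y>0 ]) i ≤ c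
quotient-bound {a} {x} {y} {c} x>0@(ε , ε>0 , M , hx) y>0@(η , η>0 , N , hy) c≥0 cη≡1 a≤x i =
  *-cancel {A * I} {c} (X * Y) (tail>0 i) (begin
    A * I * (X * Y)    ≡⟨ *-assoc A I (X * Y) ⟩
    A * (I * (X * Y))  ≡⟨ cong (A *_) (*-inverseˡ (X * Y) {{>-nonZero (tail>0 i)}}) ⟩
    A * 1ℚ             ≡⟨ *-identityʳ A ⟩
    A                  ≤⟨ a≤x (ℕₚ.m≤n+m i (M ℕ.+ N)) ⟩
    X                  ≡⟨ sym (*-identityʳ X) ⟩
    X * 1ℚ             ≡⟨ cong (X *_) (sym cη≡1) ⟩
    X * (c * η)        ≤⟨ *-monoˡ {c * η} {c * Y} X X≥0 (*-monoˡ {η} {Y} c c≥0 η≤Y) ⟩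
    X * (c * Y)        ≡⟨ solve 3 (λ X c Y → X :* (c :* Y) := c :* (X :* Y)) refl X c Y ⟩
    c * (X * Y)        ∎)
  where
  open ≤-Reasoning
  open Tail (x *ℝ y) (*ℝ-pos {x} {y} x>0 y>0) using (tail>0)
  l : ℕ
  l = M ℕ.+ N ℕ.+ i
  A X Y I : ℚ
  A = seq a i
  X = seq x l
  Y = seq y l
  I = (1/ (X * Y)) {{>-nonZero (tail>0 i)}}
  X≥0 : 0ℚ ≤ X
  X≥0 = ≤-trans (<⇒≤ ε>0) (subst (_≤ X) (+-identityˡ ε)
    (hx l (ℕₚ.≤-trans (ℕₚ.m≤m+n M N) (ℕₚ.m≤m+n (M ℕ.+ N) i))))
  η≤Y : η ≤ Y
  η≤Y = subst (_≤ Y) (+-identityˡ η)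
    (hy l (ℕₚ.≤-trans (ℕₚ.m≤n+m N M) (ℕₚ.m≤m+n (M ℕ.+ N) i)))

-- Existence of a larger number satisfying the inequality

÷-≥ : ∀ {p q r} .{{_ : Data.Rational.Base.NonZero r}} → 0ℚ < r → p * r ≤ q → p ≤ q ÷ r
÷-≥ {p} {q} {r} r>0 pr≤q = *-cancel {p} {q ÷ r} r r>0 (subst (p * r ≤_)
  (sym (trans (*-assoc q (1/ r) r) (trans (cong (q *_) (*-inverseˡ r)) (*-identityʳ q)))) pr≤q)

archimedean-≥ : ∀ p → 0ℚ < p → ∃[ k ] p ≤ fromℕ k
archimedean-≥ p p>0 =
  let (q , q>0 , qp≡1) = reciprocal p p>0
      (k , 1≤kq)       = archimedean q q>0
  in k , subst₂ _≤_ (*-identityˡ p)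
    (trans (*-assoc (fromℕ k) q p) (trans (cong (fromℕ k *_) qp≡1) (*-identityʳ (fromℕ k))))
    (*-monoʳ {1ℚ} {fromℕ k * q} p (<⇒≤ p>0) 1≤kq)

-- The quotient of logarithms is at most `c`, so the left-hand side is at most `1 + c`; the
-- remaining 1 in `2ℚ + c` is the rational gap that witnesses `<ℝ`.
exceeds : ∀ {m n c} (3≤m : 3 ℕ.≤ m) (m<n : m ℕ.< n) →
  let open Inequality 3≤m m<n in
  0ℚ ≤ c → c * proj₁ loglogm>0 ≡ 1ℚ → (2ℚ + c) * abundancy m ≤ abundancy n →
  Exceeds 3≤m m<n
exceeds {m} {n} {c} 3≤m m<n c≥0 cη≡1 h = 1ℚ , 0<1 , 0 , λ i _ → begin
  1ℚ + Q i + 1ℚ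
    ≤⟨ +-monoˡ-≤ 1ℚ (+-monoʳ-≤ 1ℚ (quotient-bound {logℚ (+ n / m) n/m>0} {logℕ n} {loglogm} {c}
         logn>0 loglogm>0 c≥0 cη≡1
         (logℚ-mono n/m>0 (/-positive n 1) (/-≥1 (ℕₚ.<⇒≤ m<n)) (/-≤-fromℕ n m)) i)) ⟩
  1ℚ + c + 1ℚ
    ≡⟨ solve 1 (λ c → con 1ℚ :+ c :+ con 1ℚ := con 2ℚ :+ c) refl c ⟩
  2ℚ + c
    ≤⟨ ÷-≥ {2ℚ + c} {abundancy n} {abundancy m} (abundancy-pos m) h ⟩
  abundancy n ÷ abundancy m ∎
  where
  open ≤-Reasoning
  open Inequality 3≤m m<n
  n/m>0 : 0ℚ < + n / m
  n/m>0 = /-positive n m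
  Q : ℕ → ℚ
  Q = seq (logℚ (+ n / m) n/m>0 /ℝ (logℕ n *ℝ loglogm) [ denominator-pos ])

exists-exceeding : ∀ {m} (3≤m : 3 ℕ.≤ m) → ∃[ n ] Σ[ m<n ∈ m ℕ.< n ] Exceeds 3≤m m<n
exists-exceeding {m} 3≤m =
  let (c , c>0 , cη≡1) = reciprocal η η>0
      p                = (2ℚ + c) * abundancy m
      p>0              = *-pos {2ℚ + c} {abundancy m} (+-pos {2ℚ} {c} 0<2 c>0) (abundancy-pos m)
      (k , 2p≤k)       = archimedean-≥ (2ℚ * p) (*-pos {2ℚ} {p} 0<2 p>0)
      -- Adding `m` forces `m < n` and only strengthens the bound on the abundancy.
      (n , k+m<n , h)  = σ-unbounded (k ℕ.+ m)
      m<n              = ℕₚ.≤-<-trans (ℕₚ.m≤n+m m k) k+m<n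
      instance n≢0     = ℕ.>-nonZero (ℕₚ.≤-<-trans z≤n m<n)
  in n , m<n , exceeds 3≤m m<n (<⇒≤ c>0) cη≡1
    (*-cancelˡ-≤-pos 2ℚ (≤-trans 2p≤k
      (≤-trans (fromℕ-mono (ℕₚ.m≤m+n k m)) (abundancy-≥ n (k ℕ.+ m) h))))
  where
  -- `loglogm>0` depends on `m` alone, so `suc m` serves as a placeholder and `c` is fixed before
  -- `n` is chosen.
  open Inequality 3≤m (ℕₚ.n<1+n m) using (m≢0; loglogm>0)
  η : ℚ
  η = proj₁ loglogm>0
  η>0 : 0ℚ < η
  η>0 = proj₁ (proj₂ loglogm>0)

-- The construction never stops

-- No decision procedure for `Exceeds` is at hand, so the least solution is obtained only under
-- double negation: if there were none, strong induction would refute every solution, contradicting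
-- `exists-exceeding`.
¬¬-next : ∀ {m} (3≤m : 3 ℕ.≤ m) → ¬ ¬ (∃[ n ] IsNext 3≤m n)
¬¬-next {m} 3≤m none =
  let (n , m<n , e) = exists-exceeding 3≤m in
  <-rec (λ n → ∀ (m<n : m ℕ.< n) → ¬ Exceeds 3≤m m<n)
    (λ n below m<n e → none (n , m<n , e , λ j m<j j<n → below j<n m<j)) n m<n e

-- Terms increase strictly from 10080. This bound supplies both `3 ≤ m` for the next step and
-- arbitrarily large elements of `X′`.
Term-≥ : ∀ k {n} → Term k n → 10080 ℕ.+ k ℕ.≤ n
Term-≥ zero    refl = toWitness {a? = 10080 ℕₚ.≤? 10080} _
Term-≥ (suc k) {n} (m , _ , t , m<n , _) = begin
  10080 ℕ.+ suc k    ≡⟨ ℕₚ.+-suc 10080 k ⟩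
  suc (10080 ℕ.+ k)  ≤⟨ s≤s (Term-≥ k t) ⟩
  suc m              ≤⟨ m<n ⟩
  n                  ∎
  where open ℕₚ.≤-Reasoning

¬¬-Term : ∀ k → ¬ ¬ (∃[ n ] Term k n)
¬¬-Term zero    none = none (10080 , refl)
¬¬-Term (suc k) none = ¬¬-Term k λ (m , t) →
  let 3≤m = ℕₚ.≤-trans (ℕₚ.≤-trans (toWitness {a? = 3 ℕₚ.≤? 10080} _) (ℕₚ.m≤m+n 10080 k)) (Term-≥ k t)
  in ¬¬-next 3≤m λ (n , next) → none (n , m , 3≤m , t , next)

theorem1p5 : Inf X′
-- `Inf` is a negation, so the double negation on the existence of term `i` is harmless; that term
-- is at least `i`, where `beyond` excludes all members.
theorem1p5 (i , beyond) = ¬¬-Term i λ (n , t) →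
  beyond n (ℕₚ.≤-trans (ℕₚ.m≤n+m i 10080) (Term-≥ i t)) (i , t)
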